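{- For every equivalence class $[\mathcal F]\in\beta\mathbb N/{=_\sim}$ which is not a singleton, at least one of the following conditions is satisfied: (1) there is $\mathcal P^u\in\mathcal B$ such that $\alpha_{\mathcal F}(\mathcal P^u)=\infty$; or (2) there is $\mathcal P^u\in\mathcal B$ of the second kind such that $\alpha_{\mathcal F}(\mathcal P^u)>0$.
   Context: Divisibility of ultrafilters. $\mathbb N=\{1,2,3,\dots\}$, $\mathbb P$ is the set of primes, $\beta\mathbb N$ is the set of ultrafilters on $\mathbb N$, with $n\in\mathbb N$ identified with the principal ultrafilter at $n$. For $A\subseteq\mathbb N$ let $A\uparrow=\{n\in\mathbb N:(\exists a\in A)\,a\mid n\}$, and $\mathcal U=\{A\subseteq\mathbb N: A\ne\emptyset,\ A=A\uparrow\}$. For $\mathcal F,\mathcal G\in\beta\mathbb N$: $\mathcal F\,\widetilde{\mid}\,\mathcal G$ iff $\mathcal F\cap\mathcal U\subseteq\mathcal G$; $\mathcal F=_\sim\mathcal G$ iff $\mathcal F\,\widetilde{\mid}\,\mathcal G$ and $\mathcal G\,\widetilde{\mid}\,\mathcal F$; $[\mathcal F]$ is the $=_\sim$-class of $\mathcal F$. Nonstandard extension. Standing assumption: we work in a fixed nonstandard extension ${}^*$ (of a superstructure over $\mathbb N$) which is $\mathfrak c^+$-saturated and satisfies Henson's isomorphism property (any two elementarily equivalent internally presented structures, for a finite first-order language, are isomorphic). In particular all sets $[1,z]=\{a\in{}^*\mathbb N:a\le z\}$ with $z\in{}^*\mathbb N\setminus\mathbb N$ have the same cardinality, denoted $\infty$.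 For $x\in{}^*\mathbb N$, $tp(x/\mathbb N)=\{A\subseteq\mathbb N:x\in{}^*A\}\in\beta\mathbb N$; $x\models\mathcal F$ ($x$ is a generator of $\mathcal F$) means $tp(x/\mathbb N)=\mathcal F$. Basic classes. $\overline{\mathbb P}=\{\mathcal P\in\beta\mathbb N:\mathbb P\in\mathcal P\}$. For $\mathcal P\in\overline{\mathbb P}$, on pairs $(p,a)$ with $p\models\mathcal P$, $a\in{}^*\mathbb N$, put $(p,a)\approx_{\mathcal P}(q,b)$ iff $tp(p^a/\mathbb N)=_\sim tp(q^b/\mathbb N)$; $\mathcal E_{\mathcal P}$ is the set of $\approx_{\mathcal P}$-classes. For $u\in\mathcal E_{\mathcal P}$ the set $\mathcal P^u=\{tp(p^a/\mathbb N):(p,a)\in u\}$ is called a basic class, and $\mathcal B$ is the set of all basic classes (for all $\mathcal P\in\overline{\mathbb P}$ and $u\in\mathcal E_{\mathcal P}$). $p^a\models\mathcal P^u$ means that $p^a$ is a generator of some ultrafilter in $\mathcal P^u$. Kinds. If $\mathcal P\in\overline{\mathbb P}\setminus\mathbb P$ (i.e. $\mathcal P$ is a nonprincipal prime ultrafilter), one distinguishes the basic classes $\mathcal P^u$ of the first kind, those such that, for every $p\models\mathcal P$, the set $u_p=\{a\in{}^*\mathbb N:p^a\models\mathcal P^u\}$ is a singleton, and those of the second kind, such that, for every $p\models\mathcal P$, $u_p$ is a union of consecutive galaxies (blocks of order type $(\mathbb Z,<)$ in ${}^*\mathbb N$). Patterns. $\mathbb N_\infty=\{0,1,2,\dots\}\cup\{\infty\}$.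 For $x\in{}^*\mathbb N$, $p\in{}^*\mathbb P$, $a\in{}^*\mathbb N$, $p^a\,{}^*\!\!\parallel x$ means $x=p^ax'$ with $p$ not dividing $x'$ (in the sense of the extended divisibility relation on ${}^*\mathbb N$). The pattern of $x$ is $\alpha_x:\mathcal B\to\mathbb N_\infty$, $\alpha_x(\mathcal P^u)=|\{(p,a):p^a\models\mathcal P^u,\ p^a\,{}^*\!\!\parallel x\}|$ (this cardinality is known to lie in $\mathbb N_\infty$). For $\mathcal F\in\beta\mathbb N$, $\alpha_{\mathcal F}:=\alpha_x$ for any $x\models\mathcal F$ (known to be independent of $x$).
   Formalization: "Of the second kind" is applied by its defining condition to all prime ultrafilters, including principal ones; with kinds only for nonprincipal ones the claim fails for F = tp(2^a), a infinite, whose class is not a singleton and whose only nonzero multiplicity is 1 at a class of powers of 2. -}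

module Defs where

open import Axiom.ExcludedMiddle using (ExcludedMiddle)
open import Axiom.Extensionality.Propositional using (Extensionality)
open import Data.Bool using (Bool; true; false; T; not; _∧_)
open import Data.Empty using (⊥)
open import Data.Fin using (Fin; zero; suc)
open import Data.Irrelevant using ([_])
open import Data.List using (List; []; _∷_)
open import Data.List.Membership.Propositional using (_∈_)
open import Data.List.Relation.Unary.All as All using (All; []; _∷_)
open import Data.Nat using (ℕ; zero; suc; NonZero; _+_; _*_; _^_; _≤?_)
open import Data.Nat.Divisibility using (_∣?_)
open import Data.Nat.Primality using (prime?)
open import Data.Nat.Properties using (m*n≢0; m^n≢0)
open import Data.Product using (Σ; ∃; ∃-syntax; _×_; _,_; proj₁; proj₂)
open import Data.Refinement using (Refinement; Refinement-syntax; _,_; value)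
open import Data.Sum using (_⊎_)
open import Data.Unit using (⊤; tt)
open import Data.Vec.Functional as Vector using (Vector)
open import Function using (_∘_)
open import Function.Bundles using (_⇔_; _↔_; _↣_; Inverse)
open import Level using (0ℓ)
open import Relation.Binary.PropositionalEquality using (_≡_; _≢_)
open import Relation.Nullary using (¬_; does)
open import Relation.Unary using (Pred)

-- The metatheory of the theorem is classical set theory.  Excluded middle for
-- arbitrary types (which, `Dec` being untruncated, also yields choice) and
-- function extensionality are explicit hypotheses of the theorem.  Under them a
-- function into `Bool` is the same thing as a subset, so subsets of the standard
-- objects are represented by characteristic functions.

Classical : ∀ ℓ → Set (Level.suc ℓ)
Classical ℓ = ExcludedMiddle ℓ × Extensionality ℓ ℓ

------------------------------------------------------------------------
-- The positive integers

ℕ⁺ : Set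
ℕ⁺ = [ n ∈ ℕ ∣ NonZero n ]

_*⁺_ : ℕ⁺ → ℕ⁺ → ℕ⁺
(m , [ p ]) *⁺ (n , [ q ]) = m * n , [ m*n≢0 m n ⦃ p ⦄ ⦃ q ⦄ ]

_^⁺_ : ℕ⁺ → ℕ⁺ → ℕ⁺
(m , [ p ]) ^⁺ (n , _) = m ^ n , [ m^n≢0 m n ⦃ p ⦄ ]

_+⁺_ : ℕ⁺ → ℕ⁺ → ℕ⁺
(suc m , _) +⁺ (n , _) = suc (m + n) , [ _ ]

------------------------------------------------------------------------
-- The superstructure over ℕ⁺, organised by finite types

infixr 6 _⊗_
infixr 5 _⇒_

data Ty : Set where
  ι 𝟙     : Ty
  _⊗_ _⇒_ : Ty → Ty → Ty
  𝒫       : Ty → Ty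

⟦_⟧ : Ty → Set
⟦ ι ⟧     = ℕ⁺
⟦ 𝟙 ⟧     = ⊤
⟦ σ ⊗ τ ⟧ = ⟦ σ ⟧ × ⟦ τ ⟧
⟦ σ ⇒ τ ⟧ = ⟦ σ ⟧ → ⟦ τ ⟧
⟦ 𝒫 σ ⟧   = ⟦ σ ⟧ → Bool

record TypeStructure : Set₁ where
  infixl 9 _·_
  infix  4 _∈ᵇ_ _∈′_
  field
    Obj   : Ty → Set
    unit  : Obj 𝟙
    ⟨_,_⟩ : ∀ {σ τ} → Obj σ → Obj τ → Obj (σ ⊗ τ)
    π₁    : ∀ {σ τ} → Obj (σ ⊗ τ) → Obj σ
    π₂    : ∀ {σ τ} → Obj (σ ⊗ τ) → Obj τ
    _·_   : ∀ {σ τ} → Obj (σ ⇒ τ) → Obj σ → Obj τ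
    _∈ᵇ_  : ∀ {σ} → Obj σ → Obj (𝒫 σ) → Bool

  _∈′_ : ∀ {σ} → Obj σ → Obj (𝒫 σ) → Set
  x ∈′ A = T (x ∈ᵇ A)

standard : TypeStructure
standard = record
  { Obj   = ⟦_⟧
  ; unit  = tt
  ; ⟨_,_⟩ = _,_
  ; π₁    = proj₁
  ; π₂    = proj₂
  ; _·_   = λ f x → f x
  ; _∈ᵇ_  = λ x A → A x
  }

-- Formulas of the language with a constant for every standard object.  A type is
-- a set of the superstructure, so quantification over a type is a bounded
-- quantification in the set-theoretic sense.

data Term (Γ : List Ty) : Ty → Set where
  var   : ∀ {σ} → σ ∈ Γ → Term Γ σ
  con   : ∀ {σ} → ⟦ σ ⟧ → Term Γ σ
  unitᵗ : Term Γ 𝟙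
  pair  : ∀ {σ τ} → Term Γ σ → Term Γ τ → Term Γ (σ ⊗ τ)
  fst   : ∀ {σ τ} → Term Γ (σ ⊗ τ) → Term Γ σ
  snd   : ∀ {σ τ} → Term Γ (σ ⊗ τ) → Term Γ τ
  app   : ∀ {σ τ} → Term Γ (σ ⇒ τ) → Term Γ σ → Term Γ τ

data Formula (Γ : List Ty) : Set where
  _≐ᶠ_           : ∀ {σ} → Term Γ σ → Term Γ σ → Formula Γ
  _∈ᶠ_           : ∀ {σ} → Term Γ σ → Term Γ (𝒫 σ) → Formula Γ
  ¬ᶠ_            : Formula Γ → Formula Γ
  _∧ᶠ_ _∨ᶠ_ _⇒ᶠ_ : Formula Γ → Formula Γ → Formula Γ
  ∀ᶠ ∃ᶠ          : ∀ σ → Formula (σ ∷ Γ) → Formula Γ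

Sentence : Set
Sentence = Formula []

module Semantics (M : TypeStructure)
                 (⌜_⌝ : ∀ {σ} → ⟦ σ ⟧ → TypeStructure.Obj M σ) where
  open TypeStructure M

  eval : ∀ {Γ σ} → All Obj Γ → Term Γ σ → Obj σ
  eval ρ (var x)    = All.lookup ρ x
  eval ρ (con a)    = ⌜ a ⌝
  eval ρ unitᵗ      = unit
  eval ρ (pair t u) = ⟨ eval ρ t , eval ρ u ⟩
  eval ρ (fst t)    = π₁ (eval ρ t)
  eval ρ (snd t)    = π₂ (eval ρ t)
  eval ρ (app t u)  = eval ρ t · eval ρ u

  Sat : ∀ {Γ} → All Obj Γ → Formula Γ → Set
  Sat ρ (t ≐ᶠ u) = eval ρ t ≡ eval ρ u
  Sat ρ (t ∈ᶠ u) = eval ρ t ∈′ eval ρ u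
  Sat ρ (¬ᶠ φ)   = ¬ Sat ρ φ
  Sat ρ (φ ∧ᶠ ψ) = Sat ρ φ × Sat ρ ψ
  Sat ρ (φ ∨ᶠ ψ) = Sat ρ φ ⊎ Sat ρ ψ
  Sat ρ (φ ⇒ᶠ ψ) = Sat ρ φ → Sat ρ ψ
  Sat ρ (∀ᶠ σ φ) = (x : Obj σ) → Sat (x ∷ ρ) φ
  Sat ρ (∃ᶠ σ φ) = Σ (Obj σ) λ x → Sat (x ∷ ρ) φ

-- The elements of `Obj (𝒫 σ)` play the role of the internal subsets of the
-- extension of σ, those of `Obj (σ ⇒ τ)` that of the internal functions; by
-- transfer both are extensional.

record NonstandardExtension : Set₁ where
  field
    structure : TypeStructure
  open TypeStructure structure public
  infix 10 ⋆_
  field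
    ⋆_       : ∀ {σ} → ⟦ σ ⟧ → Obj σ
    transfer : (φ : Sentence) →
               Semantics.Sat standard (λ a → a) [] φ ⇔ Semantics.Sat structure ⋆_ [] φ

------------------------------------------------------------------------
-- First-order structures

record Language : Set where
  field
    #rel #fun : ℕ
    relArity  : Fin #rel → ℕ
    funArity  : Fin #fun → ℕ

module _ (L : Language) where
  open Language L

  data FOTerm (n : ℕ) : Set where
    var : Fin n → FOTerm n
    fun : (f : Fin #fun) → Vector (FOTerm n) (funArity f) → FOTerm n

  data FOFormula (n : ℕ) : Set where
    falsum : FOFormula n
    equal  : FOTerm n → FOTerm n → FOFormula n
    rel    : (r : Fin #rel) → Vector (FOTerm n) (relArity r) → FOFormula n
    imp    : FOFormula n → FOFormula n → FOFormula n
    all    : FOFormula (suc n) → FOFormula n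

  record FOStructure : Set₁ where
    field
      Carrier : Set
      relᴵ    : (r : Fin #rel) → Vector Carrier (relArity r) → Set
      funᴵ    : (f : Fin #fun) → Vector Carrier (funArity f) → Carrier

    evalFO : ∀ {n} → Vector Carrier n → FOTerm n → Carrier
    evalFO ρ (var i)    = ρ i
    evalFO ρ (fun f ts) = funᴵ f (λ i → evalFO ρ (ts i))

    SatFO : ∀ {n} → Vector Carrier n → FOFormula n → Set
    SatFO ρ falsum      = ⊥
    SatFO ρ (equal t u) = evalFO ρ t ≡ evalFO ρ u
    SatFO ρ (rel r ts)  = relᴵ r (λ i → evalFO ρ (ts i))
    SatFO ρ (imp φ ψ)   = SatFO ρ φ → SatFO ρ ψ
    SatFO ρ (all φ)     = (x : Carrier) → SatFO (x Vector.∷ ρ) φ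

  open FOStructure

  ElementarilyEquivalent : FOStructure → FOStructure → Set
  ElementarilyEquivalent M N =
    (φ : FOFormula 0) → SatFO M Vector.[] φ ⇔ SatFO N Vector.[] φ

  record Isomorphism (M N : FOStructure) : Set where
    field
      bijection : Carrier M ↔ Carrier N
    open Inverse bijection using (to)
    field
      preservesRel : ∀ r xs → relᴵ M r xs ⇔ relᴵ N r (to ∘ xs)
      preservesFun : ∀ f xs → to (funᴵ M f xs) ≡ funᴵ N f (to ∘ xs)

------------------------------------------------------------------------
-- Saturation and the isomorphism property

module _ (N : NonstandardExtension) where
  open NonstandardExtension N

  -- A family of at most continuum many sets is one whose index set injects into
  -- ℕ → Bool.
  𝔠⁺-Saturated : Set₁
  𝔠⁺-Saturated =
    ∀ (I : Set) → I ↣ (ℕ → Bool) → ∀ {σ} (C : I → Obj (𝒫 σ)) →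
    (∀ (is : List I) → ∃[ x ] All (λ i → x ∈′ C i) is) →
    ∃[ x ] (∀ i → x ∈′ C i)

  power : Ty → ℕ → Ty
  power σ zero    = 𝟙
  power σ (suc k) = σ ⊗ power σ k

  tuple : ∀ {σ k} → Vector (Obj σ) k → Obj (power σ k)
  tuple {k = zero}  xs = unit
  tuple {k = suc k} xs = ⟨ xs zero , tuple (λ i → xs (suc i)) ⟩

  record InternallyPresented (L : Language) : Set where
    open Language L
    field
      {sort}    : Ty
      universe  : Obj (𝒫 sort)
      nonempty  : ∃[ x ] x ∈′ universe
      relation  : (r : Fin #rel) → Obj (𝒫 (power sort (relArity r)))
      function  : (f : Fin #fun) → Obj (power sort (funArity f) ⇒ sort)
      closed    : ∀ f (xs : Vector (Obj sort) (funArity f)) →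
                  (∀ i → xs i ∈′ universe) → function f · tuple xs ∈′ universe

    underlying : FOStructure L
    underlying = record
      { Carrier = Σ (Obj sort) λ x → x ∈′ universe
      ; relᴵ    = λ r xs → tuple (λ i → proj₁ (xs i)) ∈′ relation r
      ; funᴵ    = λ f xs → function f · tuple (λ i → proj₁ (xs i))
                         , closed f (λ i → proj₁ (xs i)) (λ i → proj₂ (xs i))
      }

  HensonIsomorphismProperty : Set
  HensonIsomorphismProperty =
    ∀ (L : Language) (A B : InternallyPresented L) →
    let open InternallyPresented in
    ElementarilyEquivalent L (underlying A) (underlying B) →
    Isomorphism L (underlying A) (underlying B)

------------------------------------------------------------------------
-- Ultrafilters on ℕ⁺ and divisibility

Subset Family : Set
Subset = ⟦ 𝒫 ι ⟧
Family = ⟦ 𝒫 (𝒫 ι) ⟧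

record Ultrafilter : Set where
  field
    family : Family
    whole  : T (family (λ _ → true))
    proper : ¬ T (family (λ _ → false))
    upward : ∀ A B → (∀ n → T (A n) → T (B n)) → T (family A) → T (family B)
    meet   : ∀ A B → T (family A) → T (family B) → T (family (λ n → A n ∧ B n))
    ultra  : ∀ A → T (family A) ⊎ T (family (λ n → not (A n)))
open Ultrafilter public using (family)

infix 4 _≋_ _∣~_ _=~_

_≋_ : Family → Family → Set
𝓕 ≋ 𝓖 = ∀ A → T (𝓕 A) ⇔ T (𝓖 A)

primes : Subset
primes n = does (prime? (value n))

divides : ⟦ 𝒫 (ι ⊗ ι) ⟧
divides (m , n) = does (value m ∣? value n)

atMost : ⟦ 𝒫 (ι ⊗ ι) ⟧
atMost (m , n) = does (value m ≤? value n)

_∈↑_ : ℕ⁺ → Subset → Set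
n ∈↑ A = ∃[ a ] T (A a) × T (divides (a , n))

𝒰 : Pred Subset 0ℓ
𝒰 A = (∃[ n ] T (A n)) × (∀ n → T (A n) ⇔ n ∈↑ A)

_∣~_ : Family → Family → Set
𝓕 ∣~ 𝓖 = ∀ A → T (𝓕 A) → 𝒰 A → T (𝓖 A)

_=~_ : Family → Family → Set
𝓕 =~ 𝓖 = 𝓕 ∣~ 𝓖 × 𝓖 ∣~ 𝓕

=~Class : Ultrafilter → Pred Ultrafilter 0ℓ
=~Class F G = family F =~ family G

IsSingleton : Pred Ultrafilter 0ℓ → Set
IsSingleton C = ∃[ H ] ∀ G → C G ⇔ family G ≋ family H

data ℕ∞ : Set where
  fin : ℕ → ℕ∞
  ∞   : ℕ∞

------------------------------------------------------------------------
-- Basic classes, kinds and patterns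

module Patterns (N : NonstandardExtension) where
  open NonstandardExtension N

  *ℕ : Set
  *ℕ = Obj ι

  infix  4 _*≤_ _*∣_ _⊨_
  infixl 7 _*·_
  infixl 6 _*+_
  infixr 8 _*^_

  _*≤_ _*∣_ : *ℕ → *ℕ → Set
  a *≤ b = ⟨ a , b ⟩ ∈′ ⋆ atMost
  a *∣ b = ⟨ a , b ⟩ ∈′ ⋆ divides

  _*·_ _*+_ _*^_ : *ℕ → *ℕ → *ℕ
  a *· b = ⋆_ {ι ⊗ ι ⇒ ι} (λ (m , n) → m *⁺ n) · ⟨ a , b ⟩
  a *+ b = ⋆_ {ι ⊗ ι ⇒ ι} (λ (m , n) → m +⁺ n) · ⟨ a , b ⟩
  a *^ b = ⋆_ {ι ⊗ ι ⇒ ι} (λ (m , n) → m ^⁺ n) · ⟨ a , b ⟩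

  Infinite : Pred *ℕ 0ℓ
  Infinite z = ∀ (n : ℕ⁺) → z ≢ ⋆ n

  tp : *ℕ → Family
  tp x A = x ∈ᵇ ⋆ A

  _⊨_ : *ℕ → Family → Set
  x ⊨ 𝓕 = tp x ≋ 𝓕

  -- A basic class 𝒫ᵘ, given by 𝒫 and a representative (p , a) of u.
  record BasicClass : Set where
    field
      𝓟       : Ultrafilter
      isPrime : T (family 𝓟 primes)
      p a     : *ℕ
      p⊨𝓟     : p ⊨ family 𝓟

    u : Pred (*ℕ × *ℕ) 0ℓ
    u (q , b) = q ⊨ family 𝓟 × tp (q *^ b) =~ tp (p *^ a)

    members : Pred Family 0ℓ
    members 𝓠 = ∃[ q ] ∃[ b ] u (q , b) × 𝓠 ≋ tp (q *^ b)

    Generates : Pred *ℕ 0ℓ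
    Generates y = ∃[ 𝓠 ] members 𝓠 × y ⊨ 𝓠

    fibre : *ℕ → Pred *ℕ 0ℓ
    fibre q b = Generates (q *^ b)

  open BasicClass public using (𝓟; Generates; fibre)

  Galaxy : *ℕ → Pred *ℕ 0ℓ
  Galaxy a b = a ≡ b ⊎ (∃[ n ] (a *+ ⋆ n ≡ b ⊎ b *+ ⋆ n ≡ a))

  -- A family of galaxies is given by a set K of representatives.  Galaxies of
  -- order type ℤ are those of infinite numbers.  As the order of galaxies is
  -- dense, "consecutive" means that no intermediate galaxy is omitted.
  UnionOfConsecutiveGalaxies : Pred *ℕ 0ℓ → Set₁
  UnionOfConsecutiveGalaxies S = Σ (Pred *ℕ 0ℓ) λ K →
    (∃[ k ] K k) ×
    (∀ k → K k → Infinite k) ×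
    (∀ b → S b ⇔ (∃[ k ] K k × Galaxy k b)) ×
    (∀ k l m → K k → K l → k *≤ m → m *≤ l → ∃[ j ] K j × Galaxy j m)

  -- The condition is not restricted to nonprincipal 𝒫.  For 𝒫 = 2, say, the
  -- powers 2ᵃ with a infinite form a single basic class, with u₂ the union of all
  -- galaxies of infinite numbers; it has to count as being of the second kind, as
  -- [tp(2ᵃ)] is not a singleton while no basic class has infinite multiplicity.
  SecondKind : BasicClass → Set₁
  SecondKind B = ∀ q → q ⊨ family (𝓟 B) → UnionOfConsecutiveGalaxies (fibre B q)

  -- Subsets are turned into types with irrelevant membership proofs, so that
  -- bijections count elements and not proofs.
  HasCardinality : {A : Set} → Pred A 0ℓ → ℕ∞ → Set
  HasCardinality {A} S (fin n) = Refinement A S ↔ Fin n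
  HasCardinality {A} S ∞       =
    ∀ z → Infinite z → Refinement A S ↔ [ a ∈ *ℕ ∣ a *≤ z ]

  ExactPower : *ℕ → *ℕ → *ℕ → Set
  ExactPower p a x = ∃[ x′ ] x ≡ (p *^ a) *· x′ × ¬ (p *∣ x′)

  Occurrences : *ℕ → BasicClass → Pred (*ℕ × *ℕ) 0ℓ
  Occurrences x B (p , a) =
    p ∈′ ⋆ primes × Generates B (p *^ a) × ExactPower p a x

  -- α_𝓕(B) = κ
  Multiplicity : Ultrafilter → BasicClass → ℕ∞ → Set
  Multiplicity F B κ = ∀ x → x ⊨ family F → HasCardinality (Occurrences x B) κ

{-# OPTIONS --safe #-}

-- If [F] is not a singleton, saturation gives x ∣ y ∣ x′ with x and x′ generating F and y
-- another member of the class, so x ≠ x′ and some exact prime power of x′ does not divide x.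
-- Types of powers of primes of a fixed type are linearly ordered by ∣~, so by saturation one
-- such power p ^ b has ∣~-maximal type; let B be its basic class.  The pairs of B occurring in x
-- form an intersection of continuum many internal sets.  Either one of their finite
-- intersections is finite, and a smallest one is then the whole intersection, of a size that
-- depends on F only; or the intersection contains an infinite internal set, and the isomorphism
-- property for the empty language shows that the multiplicity is ∞.  In the finite case x and x′
-- have equally many occurrences of B, so some q ^ c of class B is exact in x but not in x′; the
-- exponent of q in x′ is some e > c, and by maximality q ^ e is again of class B.  Hence the
-- exponents of B are not definable from the prime by a standard function g: the multiples of
-- the prime powers m ^ g m, and of the m ^ (g m + 1), would separate c from e.  Any A in 𝒰
-- separating successive exponents would define one of them, so the fibres of B are unions of
-- galaxies.

module Submission where

open import Defs
open import Data.List.Relation.Unary.All as All using (All; []; _∷_)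
open import Data.Vec.Functional as Vector using (Vector)
open import Axiom.ExcludedMiddle using (ExcludedMiddle)
open import Axiom.Extensionality.Propositional using (Extensionality)
open import Data.Bool using (Bool; true; false; T; not; _∧_)
open import Data.Bool.Properties using (T-∧)
open import Data.Empty using (⊥; ⊥-elim)
open import Data.Fin using (Fin; zero; suc; toℕ)
open import Data.Fin.Properties using (pigeonhole; toℕ-injective; <⇒≢; suc-injective)
open import Data.Irrelevant using ([_])
open import Data.List using (List; []; _∷_; map)
open import Data.List.Membership.Propositional using (_∈_)
open import Data.List.Relation.Unary.All.Properties using (map⁻)
open import Data.List.Relation.Unary.Any using (here; there)
open import Data.Nat using (ℕ; zero; suc; NonZero; _+_; _*_; _^_; _≤_; _<_; z≤n; s≤s; s<s; _≤?_; ≢-nonZero; ≢-nonZero⁻¹; >-nonZero)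
open import Data.Nat.Divisibility using (_∣_; _∣?_; _∣0; ∣-refl; ∣-trans; ∣-antisym; ∣⇒≤; m∣m*n; *-cancelˡ-∣; *-monoʳ-∣; *-monoˡ-∣) renaming (divides to mk∣)
open import Data.Nat.Induction using (<-rec)
open import Data.Nat.Primality using (Prime; prime?; euclidsLemma; prime⇒nonZero; prime⇒nonTrivial; prime⇒irreducible; prime[2])
open import Data.Nat.Primality.Factorisation using (factorise)
open import Data.Product using (Σ; ∃; ∃-syntax; ∃₂; _×_; _,_; proj₁; proj₂)
open import Data.Refinement using (_,_; value; Refinement; Refinement-syntax)
open import Data.Refinement.Properties using (value-injective)
open import Data.Sum using (_⊎_; inj₁; inj₂)
open import Function using (_∘_; Injective; case_of_)
open import Function.Bundles using (_⇔_; _↣_; Equivalence; mk⇔; mk↣; _↔_; Inverse; Injection; mk⤖; mk↔ₛ′)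
open import Function.Consequences.Propositional using (strictlySurjective⇒surjective)
open import Function.Construct.Composition using (_↔-∘_)
open import Function.Properties.Bijection using (⤖⇒↔)
open import Function.Properties.Inverse using (↔⇒↣)
open import Level using (0ℓ)
open import Relation.Binary.PropositionalEquality using (_≡_; _≢_; refl; sym; trans; cong; subst; subst₂; module ≡-Reasoning; cong₂; cong-app)
open import Relation.Nullary using (¬_; Dec; yes; no; does; contradiction; decidable-stable; recompute)
open import Relation.Nullary.Decidable using (T?)
import Data.Nat as ℕ
import Data.Nat.Properties as ℕ
import Data.Sum as Sum

-- Reflected decisions and prime powers in `ℕ`.

T-does⁻ : ∀ {ℓ} {P : Set ℓ} (d : Dec P) → T (does d) → P
T-does⁻ (yes p) _ = p

T-does⁺ : ∀ {ℓ} {P : Set ℓ} (d : Dec P) → P → T (does d)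
T-does⁺ (yes _) _ = _
T-does⁺ (no ¬p) p = ¬p p

T-prop : ∀ {b} (p q : T b) → p ≡ q
T-prop {true} _ _ = refl

prime⇒2≤ : ∀ {p} → Prime p → 2 ≤ p
prime⇒2≤ {p} pp = ℕ.nonTrivial⇒n>1 p ⦃ prime⇒nonTrivial pp ⦄

prime∣prime : ∀ {p q} → Prime p → Prime q → p ∣ q → p ≡ q
prime∣prime pp pq p∣q with prime⇒irreducible pq p∣q
... | inj₁ refl = contradiction (prime⇒2≤ pp) λ { (s≤s ()) }
... | inj₂ p≡q = p≡q

prime∣power : ∀ {p q} a → Prime p → Prime q → p ∣ q ^ a → p ≡ q
prime∣power zero pp pq d = contradiction (prime⇒2≤ pp) λ 2≤p →
  ℕ.<⇒≱ 2≤p (∣⇒≤ d)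
prime∣power {q = q} (suc a) pp pq d with euclidsLemma q (q ^ a) pp d
... | inj₁ p∣q = prime∣prime pp pq p∣q
... | inj₂ e   = prime∣power a pp pq e

^-mono-∣ : ∀ p {a b} → a ≤ b → p ^ a ∣ p ^ b
^-mono-∣ p {a} a≤b with k , refl ← ℕ.m≤n⇒∃[o]m+o≡n a≤b =
  subst (p ^ a ∣_) (sym (ℕ.^-distribˡ-+-* p a k)) (m∣m*n (p ^ k))

^-reflects-∣ : ∀ {p} → 2 ≤ p → ∀ a b → p ^ a ∣ p ^ b → a ≤ b
^-reflects-∣ {p} 2≤p a b d = ℕ.≮⇒≥ λ b<a →
  ℕ.<⇒≱ (ℕ.^-monoʳ-< p 2≤p b<a)
        (∣⇒≤ ⦃ ℕ.m^n≢0 p b ⦃ >-nonZero (ℕ.<⇒≤ 2≤p) ⦄ ⦄ d)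

power∣exact⇒≤ : ∀ {p} → Prime p → ∀ a b k → ¬ p ∣ k → p ^ b ∣ p ^ a * k → b ≤ a
power∣exact⇒≤ pp a zero k p∤k d = z≤n
power∣exact⇒≤ {p} pp zero (suc b) k p∤k d =
  contradiction (∣-trans (m∣m*n (p ^ b)) (subst (p * p ^ b ∣_) (ℕ.*-identityˡ k) d)) p∤k
power∣exact⇒≤ {p} pp (suc a) (suc b) k p∤k d =
  s≤s (power∣exact⇒≤ pp a b k p∤k
    (*-cancelˡ-∣ p ⦃ prime⇒nonZero pp ⦄ (subst (p * p ^ b ∣_) (ℕ.*-assoc p (p ^ a) k) d)))

exactPower : ∀ {p} → Prime p → ∀ n → .⦃ NonZero n ⦄ → ∃₂ λ a k → n ≡ p ^ a * k × ¬ p ∣ k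
exactPower {p} pp = <-rec (λ n → .⦃ NonZero n ⦄ → ∃₂ λ a k → n ≡ p ^ a * k × ¬ p ∣ k) step
  where
  step : ∀ n → (∀ {m} → m < n → .⦃ NonZero m ⦄ → ∃₂ λ a k → m ≡ p ^ a * k × ¬ p ∣ k) →
         .⦃ NonZero n ⦄ → ∃₂ λ a k → n ≡ p ^ a * k × ¬ p ∣ k
  step n rec with p ∣? n
  ... | no p∤n = 0 , n , sym (ℕ.*-identityˡ n) , p∤n
  ... | yes (mk∣ (suc m) refl)
    with a , k , eq , p∤k ← rec (ℕ.m<m*n (suc m) p (prime⇒2≤ pp)) =
    suc a , k , trans (cong (_* p) eq) (trans (ℕ.*-comm _ p) (sym (ℕ.*-assoc p (p ^ a) k))) , p∤k

primeDivisor : ∀ n → .⦃ NonZero n ⦄ → n ≢ 1 → ∃[ p ] Prime p × p ∣ n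
primeDivisor n n≢1 with factorise n
... | record { factors = [] ; isFactorisation = eq } = contradiction eq n≢1
... | record { factors = p ∷ ps ; isFactorisation = eq ; factorsPrime = pp ∷ _ } =
  p , pp , subst (p ∣_) (sym eq) (m∣m*n _)

-- Exact prime powers of positive integers.

ℕ⁺-≡ : {m n : ℕ⁺} → value m ≡ value n → m ≡ n
ℕ⁺-≡ refl = refl

value≥1 : (n : ℕ⁺) → 1 ≤ value n
value≥1 (suc n , _) = s≤s z≤n

value-+⁺ : ∀ m n → value (m +⁺ n) ≡ value m + value n
value-+⁺ (suc m , _) n = refl

1⁺ 2⁺ : ℕ⁺
1⁺ = 1 , [ _ ]
2⁺ = 2 , [ _ ]

primes⁻ : ∀ {p} → T (primes p) → Prime (value p)
primes⁻ = T-does⁻ (prime? _)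

divides⁻ : ∀ m n → T (divides (m , n)) → value m ∣ value n
divides⁻ m n = T-does⁻ (value m ∣? value n)

divides⁺ : ∀ m n → value m ∣ value n → T (divides (m , n))
divides⁺ m n = T-does⁺ (value m ∣? value n)

atMost⁻ : ∀ m n → T (atMost (m , n)) → value m ≤ value n
atMost⁻ m n = T-does⁻ (value m ≤? value n)

atMost⁺ : ∀ m n → value m ≤ value n → T (atMost (m , n))
atMost⁺ m n = T-does⁺ (value m ≤? value n)

Exact⁺ : ℕ⁺ → ℕ⁺ → ℕ⁺ → Set
Exact⁺ p a n = ∃[ k ] n ≡ (p ^⁺ a) *⁺ k × ¬ T (divides (p , k))

-- Exponents in `ℕ⁺` start at 1, so `p` has to divide `n`: this excludes the exponent zero that
-- `exactPower` allows.
exact⁺ : ∀ {p n} → T (primes p) → value p ∣ value n → ∃[ a ] Exact⁺ p a n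
exact⁺ {p} {n@(_ , [ n≢0 ])} pp d with exactPower (primes⁻ {p} pp) (value n) ⦃ n≢0 ⦄
... | zero , k , eq , p∤k =
  contradiction (subst (value p ∣_) (trans eq (ℕ.*-identityˡ k)) d) p∤k
... | a@(suc _) , k , eq , p∤k =
  (a , [ _ ]) , k⁺ , ℕ⁺-≡ eq , λ d → p∤k (divides⁻ p k⁺ d)
  where
  k⁺ : ℕ⁺
  k⁺ = k , [ ≢-nonZero (λ { refl → p∤k (value p ∣0) }) ]

-- As the exponent `e` is at least 1, `m` itself divides the power of `p`, which forces `m ≡ p`; the
-- exponents are then compared.
power∣power : ∀ {m p} e a → T (primes m) → T (primes p) →
              T (divides (m ^⁺ e , p ^⁺ a)) → m ≡ p × T (atMost (e , a))
power∣power {m} {p} e@(suc e′ , _) a mp pp d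
  with refl ← ℕ⁺-≡ {m} {p} (prime∣power (value a) (primes⁻ {m} mp) (primes⁻ {p} pp)
                     (∣-trans (m∣m*n (value m ^ e′)) (divides⁻ (m ^⁺ e) (p ^⁺ a) d))) =
  refl , atMost⁺ e a (^-reflects-∣ (prime⇒2≤ (primes⁻ {p} pp)) (value e) (value a)
                        (divides⁻ (p ^⁺ e) (p ^⁺ a) d))

exact-bound : ∀ {p n} a b → T (primes p) → Exact⁺ p a n →
              T (divides (p ^⁺ b , n)) → T (atMost (b , a))
exact-bound {p} {n} a b pp (k , refl , p∤k) d =
  atMost⁺ b a (power∣exact⇒≤ (primes⁻ {p} pp) (value a) (value b) (value k)
                 (λ e → p∤k (divides⁺ p k e)) (divides⁻ (p ^⁺ b) n d))

exact⇒divides : ∀ {p n} a → Exact⁺ p a n → T (divides (p ^⁺ a , n))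
exact⇒divides {p} {n} a (k , refl , _) = divides⁺ (p ^⁺ a) n (m∣m*n (value k))

exact-lift : ∀ {p x y} a → T (primes p) → Exact⁺ p a x → T (divides (x , y)) →
             ∃[ b ] Exact⁺ p b y × T (atMost (a , b))
exact-lift {p} {x} {y} a@(suc a′ , _) pp ex x∣y =
  let p^a∣y = ∣-trans (divides⁻ (p ^⁺ a) x (exact⇒divides {p} a ex)) (divides⁻ x y x∣y)
      b , ey = exact⁺ {p} {y} pp (∣-trans (m∣m*n (value p ^ a′)) p^a∣y)
  in b , ey , exact-bound {p} b a pp ey (divides⁺ (p ^⁺ a) y p^a∣y)

-- Take for `p` a prime factor of the cofactor `y / x`, which is not 1. If `p ^ b` divided `x`, this
-- extra factor would make `p ^ (b + 1)` divide `y`, against the exactness of `b`.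
separatingPower : ∀ {x y} → T (divides (x , y)) → x ≢ y →
                  ∃₂ λ p b → T (primes p) × Exact⁺ p b y × ¬ T (divides (p ^⁺ b , x))
separatingPower {x} {y@(_ , [ y≢0 ])} x∣y x≢y = separate (divides⁻ x y x∣y)
  where
  separate : value x ∣ value y →
             ∃₂ λ p b → T (primes p) × Exact⁺ p b y × ¬ T (divides (p ^⁺ b , x))
  separate (mk∣ k eq) = p , b , pp , ey , λ d →
    ℕ.<-irrefl refl (atMost⁻ (1⁺ +⁺ b) b (exact-bound {p} b (1⁺ +⁺ b) pp ey (p^b+1∣y d)))
    where
    k≢0 : k ≢ 0
    k≢0 refl = ≢-nonZero⁻¹ (value y) ⦃ y≢0 ⦄ eq
    k≢1 : k ≢ 1
    k≢1 refl = x≢y (ℕ⁺-≡ (sym (trans eq (ℕ.*-identityˡ _))))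
    q∣k = primeDivisor k ⦃ ≢-nonZero k≢0 ⦄ k≢1
    p : ℕ⁺
    p = proj₁ q∣k , [ prime⇒nonZero (proj₁ (proj₂ q∣k)) ]
    pp : T (primes p)
    pp = T-does⁺ (prime? (value p)) (proj₁ (proj₂ q∣k))
    p∣k : value p ∣ k
    p∣k = proj₂ (proj₂ q∣k)
    p∣y : value p ∣ value y
    p∣y = ∣-trans p∣k (mk∣ (value x) (trans eq (ℕ.*-comm k _)))
    b : ℕ⁺
    b = proj₁ (exact⁺ {p} {y} pp p∣y)
    ey : Exact⁺ p b y
    ey = proj₂ (exact⁺ {p} {y} pp p∣y)
    p^b+1∣y : T (divides (p ^⁺ b , x)) → T (divides (p ^⁺ (1⁺ +⁺ b) , y))
    p^b+1∣y d = divides⁺ (p ^⁺ (1⁺ +⁺ b)) y (subst (value p ^ suc (value b) ∣_) (sym eq)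
      (∣-trans (*-monoˡ-∣ (value p ^ value b) p∣k) (*-monoʳ-∣ k (divides⁻ (p ^⁺ b) x d))))

-- Formula combinators and universal closure.

open Equivalence using (to; from)

infixr 3 _⇔ᶠ_

_⇔ᶠ_ : ∀ {Γ} → Formula Γ → Formula Γ → Formula Γ
φ ⇔ᶠ ψ = (φ ⇒ᶠ ψ) ∧ᶠ (ψ ⇒ᶠ φ)

⊤ᶠ : ∀ {Γ} → Formula Γ
⊤ᶠ = unitᵗ ≐ᶠ unitᵗ

-- Conditions such as `𝒰 A` are decided outside the language by excluded middle. Only the answer
-- shapes the formula, so the parameters of the condition do not enter it.
guard : ∀ {Γ} {P : Set} → Dec P → Formula Γ → Formula Γ
guard (yes _) φ = φ
guard (no _)  φ = ⊤ᶠ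

-- Prescribes the truth value of `φ`; families of such formulas describe the type of an element.
decideᶠ : ∀ {Γ} {P : Set} → Dec P → Formula Γ → Formula Γ
decideᶠ (yes _) φ = φ
decideᶠ (no _)  φ = ¬ᶠ φ

⋀ᶠ : ∀ {Γ} {I : Set} → (I → Formula Γ) → List I → Formula Γ
⋀ᶠ φ []       = ⊤ᶠ
⋀ᶠ φ (i ∷ is) = φ i ∧ᶠ ⋀ᶠ φ is

∀* : ∀ Γ → Formula Γ → Sentence
∀* []      φ = φ
∀* (σ ∷ Γ) φ = ∀* Γ (∀ᶠ σ φ)

v0 : ∀ {Γ σ} → Term (σ ∷ Γ) σ
v0 = var (here refl)

v1 : ∀ {Γ σ τ} → Term (τ ∷ σ ∷ Γ) σ
v1 = var (there (here refl))

v2 : ∀ {Γ σ τ υ} → Term (υ ∷ τ ∷ σ ∷ Γ) σ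
v2 = var (there (there (here refl)))

v3 : ∀ {Γ σ τ υ ω} → Term (ω ∷ υ ∷ τ ∷ σ ∷ Γ) σ
v3 = var (there (there (there (here refl))))

-- Packing a context into one type lets a formula with parameters define a standard function of one
-- argument, which has an extension.
tupleTy : List Ty → Ty
tupleTy []      = 𝟙
tupleTy (σ ∷ Γ) = σ ⊗ tupleTy Γ

untuple : ∀ Γ → ⟦ tupleTy Γ ⟧ → All ⟦_⟧ Γ
untuple []      _       = []
untuple (σ ∷ Γ) (x , t) = x ∷ untuple Γ t

tupleTerm : ∀ Γ {Δ} → (∀ {σ} → σ ∈ Γ → σ ∈ Δ) → Term Δ (tupleTy Γ)
tupleTerm []      f = unitᵗ
tupleTerm (σ ∷ Γ) f = pair (var (f (here refl))) (tupleTerm Γ (f ∘ there))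

-- Transfer, comprehension and saturation for formulas.

module Closure (M : TypeStructure) (⌜_⌝ : ∀ {σ} → ⟦ σ ⟧ → TypeStructure.Obj M σ) where
  open TypeStructure M
  open Semantics M ⌜_⌝

  Sat-∀* : ∀ Γ {φ} → Sat [] (∀* Γ φ) ⇔ (∀ ρ → Sat ρ φ)
  Sat-∀* []      = mk⇔ (λ { s [] → s }) (λ s → s [])
  Sat-∀* (σ ∷ Γ) = mk⇔ (λ { s (x ∷ ρ) → to (Sat-∀* Γ) s ρ x })
                       (λ s → from (Sat-∀* Γ) (λ ρ x → s (x ∷ ρ)))

  Sat-guard : ∀ {Γ} {P : Set} (d : Dec P) {φ : Formula Γ} {ρ} →
              Sat ρ (guard d φ) ⇔ (P → Sat ρ φ)
  Sat-guard (yes p) = mk⇔ (λ s _ → s) (λ s → s p)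
  Sat-guard (no ¬p) = mk⇔ (λ _ p → contradiction p ¬p) (λ _ → refl)

  Sat-decide : ∀ {Γ} {P : Set} (d : Dec P) {φ : Formula Γ} {ρ} → Sat ρ (decideᶠ d φ) ⇔ (P ⇔ Sat ρ φ)
  Sat-decide (yes p) = mk⇔ (λ s → mk⇔ (λ _ → s) (λ _ → p)) (λ e → to e p)
  Sat-decide (no ¬p) = mk⇔ (λ ¬s → mk⇔ (λ p → contradiction p ¬p) (λ s → contradiction s ¬s))
                             (λ e s → ¬p (from e s))

  Sat-⋀ : ∀ {Γ} {I : Set} (φ : I → Formula Γ) (ρ : All Obj Γ) is →
          Sat ρ (⋀ᶠ φ is) ⇔ All (λ i → Sat ρ (φ i)) is
  Sat-⋀ φ ρ []       = mk⇔ (λ _ → []) (λ _ → refl)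
  Sat-⋀ φ ρ (i ∷ is) = mk⇔ (λ (s , ss) → s ∷ to (Sat-⋀ φ ρ is) ss)
                           (λ { (s ∷ ss) → s , from (Sat-⋀ φ ρ is) ss })

module Transfer (em : ExcludedMiddle 0ℓ) (N : NonstandardExtension) where
  open NonstandardExtension N public
  open Semantics structure ⋆_ public
  module Std = Semantics standard (λ a → a)
  open Closure structure ⋆_ public

  transfer∀ : ∀ {Γ} (φ : Formula Γ) → (∀ ρ → Std.Sat ρ φ) → ∀ ρ → Sat ρ φ
  transfer∀ {Γ} φ s =
    to (Sat-∀* Γ) (to (transfer (∀* Γ φ)) (from (Closure.Sat-∀* standard (λ a → a) Γ) s))

  ⌊_⌋ : ∀ {σ} → (⟦ σ ⟧ → Set) → ⟦ 𝒫 σ ⟧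
  ⌊ P ⌋ x = does (em {P x})

  ⟪_⟫ : ∀ {σ} → Formula (σ ∷ []) → ⟦ 𝒫 σ ⟧
  ⟪_⟫ {σ} φ = ⌊_⌋ {σ} (λ x → Std.Sat (x ∷ []) φ)

  ⟪⟫⁻ : ∀ {σ} (φ : Formula (σ ∷ [])) {x} → T (⟪ φ ⟫ x) → Std.Sat (x ∷ []) φ
  ⟪⟫⁻ φ = T-does⁻ em

  ⟪⟫⁺ : ∀ {σ} (φ : Formula (σ ∷ [])) {x} → Std.Sat (x ∷ []) φ → T (⟪ φ ⟫ x)
  ⟪⟫⁺ φ = T-does⁺ em

  ∈⟪_⟫ : ∀ {σ} (φ : Formula (σ ∷ [])) {x} → x ∈′ ⋆ ⟪ φ ⟫ ⇔ Sat (x ∷ []) φ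
  ∈⟪_⟫ {σ} φ {x} = mk⇔ (proj₁ h) (proj₂ h)
    where
    h = to (transfer (∀ᶠ σ ((v0 ∈ᶠ con ⟪ φ ⟫) ⇔ᶠ φ))) (λ x → ⟪⟫⁻ φ , ⟪⟫⁺ φ) x

  untuple-tupleTerm : ∀ Γ {Δ} (f : ∀ {σ} → σ ∈ Γ → σ ∈ Δ) (δ : All ⟦_⟧ Δ) (ρ : All ⟦_⟧ Γ) →
    (∀ {σ} (x : σ ∈ Γ) → All.lookup δ (f x) ≡ All.lookup ρ x) →
    untuple Γ (Std.eval δ (tupleTerm Γ f)) ≡ ρ
  untuple-tupleTerm []      f δ []      eq = refl
  untuple-tupleTerm (σ ∷ Γ) f δ (x ∷ ρ) eq =
    cong₂ _∷_ (eq (here refl)) (untuple-tupleTerm Γ (f ∘ there) δ ρ (eq ∘ there))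

  -- Internal definition principle. The standard function `F` sends a tuple of parameters to the set
  -- that `φ` defines from it; its extension, applied to the tuple of `ρ`, yields the internal set.
  comprehension : ∀ {Γ σ} (φ : Formula (σ ∷ Γ)) (ρ : All Obj Γ) →
                  Σ (Obj (𝒫 σ)) λ s → ∀ {y} → y ∈′ s ⇔ Sat (y ∷ ρ) φ
  comprehension {Γ} {σ} φ ρ = eval ρ (app (con F) (tupleTerm Γ (λ x → x))) , λ {y} →
    let h = transfer∀ ((v0 ∈ᶠ app (con F) (tupleTerm Γ there)) ⇔ᶠ φ) standardCase (y ∷ ρ)
    in mk⇔ (proj₁ h ∘ subst (λ t → y ∈′ (⋆ F · t)) (sym (weaken Γ (λ x → x) y)))
           (subst (λ t → y ∈′ (⋆ F · t)) (weaken Γ (λ x → x) y) ∘ proj₂ h)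
    where
    F : ⟦ tupleTy Γ ⇒ 𝒫 σ ⟧
    F t = ⌊_⌋ {σ} λ y → Std.Sat (y ∷ untuple Γ t) φ
    weaken : ∀ Δ (f : ∀ {σ} → σ ∈ Δ → σ ∈ Γ) (y : Obj σ) →
             eval (y ∷ ρ) (tupleTerm Δ (there ∘ f)) ≡ eval ρ (tupleTerm Δ f)
    weaken []      f y = refl
    weaken (τ ∷ Δ) f y = cong ⟨ All.lookup ρ (f (here refl)) ,_⟩ (weaken Δ (f ∘ there) y)
    standardCase : ∀ δ → Std.Sat δ ((v0 ∈ᶠ app (con F) (tupleTerm Γ there)) ⇔ᶠ φ)
    standardCase (y ∷ δ) =
      (λ s → subst (λ δ → Std.Sat (y ∷ δ) φ) eq (T-does⁻ em s)) ,
      (λ s → T-does⁺ em (subst (λ δ → Std.Sat (y ∷ δ) φ) (sym eq) s))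
      where
      eq = untuple-tupleTerm Γ there (y ∷ δ) δ (λ _ → refl)

  -- Saturation is stated for internal sets; comprehension carries it over to formulas with
  -- parameters `ρ`.
  saturate : 𝔠⁺-Saturated N → ∀ {I : Set} → I ↣ (ℕ → Bool) →
             ∀ {Γ σ} (ρ : All Obj Γ) (φ : I → Formula (σ ∷ Γ)) →
             (∀ is → ∃[ x ] All (λ i → Sat (x ∷ ρ) (φ i)) is) →
             ∃[ x ] ∀ i → Sat (x ∷ ρ) (φ i)
  saturate sat {I} inj ρ φ fip =
    let x , x∈ = sat I inj (λ i → proj₁ (comprehension (φ i) ρ))
                   (λ is → let x , h = fip is in
                           x , All.map (λ {i} → from (proj₂ (comprehension (φ i) ρ))) h)
    in x , λ i → to (proj₂ (comprehension (φ i) ρ)) (x∈ i)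

-- Arithmetic of the nonstandard numbers.

infix  21 _∣ᶠ_ _≤ᶠ_
infixl 23 _·ᵗ_
infixl 22 _+ᵗ_
infixr 24 _^ᵗ_

_·ᵗ_ _+ᵗ_ _^ᵗ_ : ∀ {Γ} → Term Γ ι → Term Γ ι → Term Γ ι
t ·ᵗ u = app (con (λ (m , n) → m *⁺ n)) (pair t u)
t +ᵗ u = app (con (λ (m , n) → m +⁺ n)) (pair t u)
t ^ᵗ u = app (con (λ (m , n) → m ^⁺ n)) (pair t u)

_∣ᶠ_ _≤ᶠ_ : ∀ {Γ} → Term Γ ι → Term Γ ι → Formula Γ
t ∣ᶠ u = pair t u ∈ᶠ con divides
t ≤ᶠ u = pair t u ∈ᶠ con atMost

_∈ₛ_ : ∀ {Γ σ} → Term Γ σ → ⟦ 𝒫 σ ⟧ → Formula Γ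
t ∈ₛ A = t ∈ᶠ con A

𝒰-closed : ∀ {A} → 𝒰 A → ∀ m n → T (A m) → T (divides (m , n)) → T (A n)
𝒰-closed (_ , up) m n m∈A m∣n = from (up n) (m , m∈A , m∣n)

𝒰-intro : ∀ {A} → ∃[ n ] T (A n) → (∀ m n → T (A m) → T (divides (m , n)) → T (A n)) → 𝒰 A
𝒰-intro ne cl = ne , λ n → mk⇔ (λ n∈A → n , n∈A , divides⁺ n n ∣-refl)
                                (λ (a , a∈A , a∣n) → cl a n a∈A a∣n)

module Arithmetic (em : ExcludedMiddle 0ℓ) (N : NonstandardExtension) where
  open Transfer em N public
  open Patterns N public

  _*<_ : *ℕ → *ℕ → Set
  a *< b = a *+ ⋆ 1⁺ *≤ b

  *≤-refl : ∀ a → a *≤ a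
  *≤-refl = to (transfer (∀ᶠ ι (v0 ≤ᶠ v0))) λ a → atMost⁺ a a ℕ.≤-refl

  *≤-trans : ∀ a b c → a *≤ b → b *≤ c → a *≤ c
  *≤-trans = to (transfer (∀ᶠ ι (∀ᶠ ι (∀ᶠ ι ((v2 ≤ᶠ v1) ⇒ᶠ ((v1 ≤ᶠ v0) ⇒ᶠ (v2 ≤ᶠ v0)))))))
    λ a b c p q → atMost⁺ a c (ℕ.≤-trans (atMost⁻ a b p) (atMost⁻ b c q))

  *≤-total : ∀ a b → a *≤ b ⊎ b *≤ a
  *≤-total = to (transfer (∀ᶠ ι (∀ᶠ ι ((v1 ≤ᶠ v0) ∨ᶠ (v0 ≤ᶠ v1)))))
    λ a b → Sum.map (atMost⁺ a b) (atMost⁺ b a) (ℕ.≤-total (value a) (value b))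

  *≤⇒≡⊎< : ∀ a b → a *≤ b → a ≡ b ⊎ a *< b
  *≤⇒≡⊎< = to (transfer (∀ᶠ ι (∀ᶠ ι ((v1 ≤ᶠ v0) ⇒ᶠ ((v1 ≐ᶠ v0) ∨ᶠ (v1 +ᵗ con 1⁺ ≤ᶠ v0))))))
    λ a b p → split a b (ℕ.m≤n⇒m<n∨m≡n (atMost⁻ a b p))
    where
    split : ∀ a b → (value a ℕ.< value b) ⊎ (value a ≡ value b) → a ≡ b ⊎ T (atMost (a +⁺ 1⁺ , b))
    split a b (inj₁ a<b) = inj₂ (atMost⁺ (a +⁺ 1⁺) b
      (subst (ℕ._≤ value b) (sym (trans (value-+⁺ a 1⁺) (ℕ.+-comm (value a) 1))) a<b))
    split a b (inj₂ eq) = inj₁ (ℕ⁺-≡ eq)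

  *<⇒≱ : ∀ a b → a *< b → ¬ b *≤ a
  *<⇒≱ = to (transfer (∀ᶠ ι (∀ᶠ ι ((v1 +ᵗ con 1⁺ ≤ᶠ v0) ⇒ᶠ (¬ᶠ (v0 ≤ᶠ v1))))))
    λ a b p q → ℕ.<⇒≱
      (subst (ℕ._≤ value b) (trans (value-+⁺ a 1⁺) (ℕ.+-comm (value a) 1)) (atMost⁻ (a +⁺ 1⁺) b p))
      (atMost⁻ b a q)

  *+-mono-≤ : ∀ a b c → a *≤ b → a *+ c *≤ b *+ c
  *+-mono-≤ = to (transfer (∀ᶠ ι (∀ᶠ ι (∀ᶠ ι ((v2 ≤ᶠ v1) ⇒ᶠ (v2 +ᵗ v0 ≤ᶠ v1 +ᵗ v0))))))
    λ a b c p → atMost⁺ (a +⁺ c) (b +⁺ c)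
      (subst₂ ℕ._≤_ (sym (value-+⁺ a c)) (sym (value-+⁺ b c)) (ℕ.+-monoˡ-≤ (value c) (atMost⁻ a b p)))

  *+-≤ : ∀ a c → a *≤ a *+ c
  *+-≤ = to (transfer (∀ᶠ ι (∀ᶠ ι (v1 ≤ᶠ v1 +ᵗ v0))))
    λ a c → atMost⁺ a (a +⁺ c) (subst (value a ℕ.≤_) (sym (value-+⁺ a c)) (ℕ.m≤m+n (value a) (value c)))

  *+-assoc : ∀ a b c → (a *+ b) *+ c ≡ a *+ (b *+ c)
  *+-assoc = to (transfer (∀ᶠ ι (∀ᶠ ι (∀ᶠ ι ((v2 +ᵗ v1) +ᵗ v0 ≐ᶠ v2 +ᵗ (v1 +ᵗ v0))))))
    λ a b c → ℕ⁺-≡ (begin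
      value ((a +⁺ b) +⁺ c)          ≡⟨ value-+⁺ (a +⁺ b) c ⟩
      value (a +⁺ b) ℕ.+ value c       ≡⟨ cong (ℕ._+ value c) (value-+⁺ a b) ⟩
      value a ℕ.+ value b ℕ.+ value c    ≡⟨ ℕ.+-assoc (value a) (value b) (value c) ⟩
      value a ℕ.+ (value b ℕ.+ value c)  ≡⟨ cong (value a ℕ.+_) (value-+⁺ b c) ⟨
      value a ℕ.+ value (b +⁺ c)       ≡⟨ value-+⁺ a (b +⁺ c) ⟨
      value (a +⁺ (b +⁺ c))          ∎)
    where open ≡-Reasoning

  ⋆-+ : ∀ m n → ⋆ (m +⁺ n) ≡ ⋆ m *+ ⋆ n
  ⋆-+ m n = to (transfer (con (m +⁺ n) ≐ᶠ con m +ᵗ con n)) refl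

  *∣-refl : ∀ a → a *∣ a
  *∣-refl = to (transfer (∀ᶠ ι (v0 ∣ᶠ v0))) λ a → divides⁺ a a ∣-refl

  *∣-trans : ∀ a b c → a *∣ b → b *∣ c → a *∣ c
  *∣-trans = to (transfer (∀ᶠ ι (∀ᶠ ι (∀ᶠ ι ((v2 ∣ᶠ v1) ⇒ᶠ ((v1 ∣ᶠ v0) ⇒ᶠ (v2 ∣ᶠ v0)))))))
    λ a b c p q → divides⁺ a c (∣-trans (divides⁻ a b p) (divides⁻ b c q))

  *∣-antisym : ∀ a b → a *∣ b → b *∣ a → a ≡ b
  *∣-antisym = to (transfer (∀ᶠ ι (∀ᶠ ι ((v1 ∣ᶠ v0) ⇒ᶠ ((v0 ∣ᶠ v1) ⇒ᶠ (v1 ≐ᶠ v0))))))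
    λ a b p q → ℕ⁺-≡ (∣-antisym (divides⁻ a b p) (divides⁻ b a q))

  *^-mono : ∀ p a b → a *≤ b → p *^ a *∣ p *^ b
  *^-mono = to (transfer (∀ᶠ ι (∀ᶠ ι (∀ᶠ ι ((v1 ≤ᶠ v0) ⇒ᶠ (v2 ^ᵗ v1 ∣ᶠ v2 ^ᵗ v0))))))
    λ p a b le → divides⁺ (p ^⁺ a) (p ^⁺ b) (^-mono-∣ (value p) (atMost⁻ a b le))

  *-power∣power : ∀ m p e a → m ∈′ ⋆ primes → p ∈′ ⋆ primes → m *^ e *∣ p *^ a → m ≡ p × e *≤ a
  *-power∣power =
    to (transfer (∀ᶠ ι (∀ᶠ ι (∀ᶠ ι (∀ᶠ ι ((v3 ∈ₛ primes) ⇒ᶠ ((v2 ∈ₛ primes) ⇒ᶠ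
         ((v3 ^ᵗ v1 ∣ᶠ v2 ^ᵗ v0) ⇒ᶠ ((v3 ≐ᶠ v2) ∧ᶠ (v1 ≤ᶠ v0))))))))))
      λ m p e a mp pp d → power∣power {m} {p} e a mp pp d

  -- As a standard set, exactness becomes one atomic formula; `Exact⇔ExactPower` recovers the
  -- existential form.
  exactPowers : ⟦ 𝒫 (ι ⊗ ι ⊗ ι) ⟧
  exactPowers = ⌊ (λ (p , a , n) → Exact⁺ p a n) ⌋

  exactᶠ : ∀ {Γ} → Term Γ ι → Term Γ ι → Term Γ ι → Formula Γ
  exactᶠ p a x = pair p (pair a x) ∈ᶠ con exactPowers

  Exact : *ℕ → *ℕ → *ℕ → Set
  Exact p a x = ⟨ p , ⟨ a , x ⟩ ⟩ ∈′ ⋆ exactPowers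

  Exact⇔ExactPower : ∀ {p a x} → Exact p a x ⇔ ExactPower p a x
  Exact⇔ExactPower {p} {a} {x} = mk⇔ (proj₁ h) (proj₂ h)
    where
    h = to (transfer (∀ᶠ ι (∀ᶠ ι (∀ᶠ ι (exactᶠ v2 v1 v0 ⇔ᶠ
              ∃ᶠ ι ((v1 ≐ᶠ (v3 ^ᵗ v2) ·ᵗ v0) ∧ᶠ (¬ᶠ (v3 ∣ᶠ v0))))))))
          (λ p a n → T-does⁻ em , T-does⁺ em) p a x

  separatingPower* : ∀ x y → x *∣ y → x ≢ y →
    ∃₂ λ p b → p ∈′ ⋆ primes × Exact p b y × ¬ (p *^ b *∣ x)
  separatingPower* =
    to (transfer (∀ᶠ ι (∀ᶠ ι ((v1 ∣ᶠ v0) ⇒ᶠ ((¬ᶠ (v1 ≐ᶠ v0)) ⇒ᶠ ∃ᶠ ι (∃ᶠ ι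
         ((v1 ∈ₛ primes) ∧ᶠ (exactᶠ v1 v0 v2 ∧ᶠ (¬ᶠ (v1 ^ᵗ v0 ∣ᶠ v3)))))))))) standardCase
    where
    standardCase : ∀ x y → T (divides (x , y)) → x ≢ y → _
    standardCase x y x∣y x≢y =
      let p , b , pp , ey , h = separatingPower {x} {y} x∣y x≢y in p , b , pp , T-does⁺ em ey , h

  exact-bound* : ∀ p n a b → p ∈′ ⋆ primes → Exact p a n → p *^ b *∣ n → b *≤ a
  exact-bound* =
    to (transfer (∀ᶠ ι (∀ᶠ ι (∀ᶠ ι (∀ᶠ ι ((v3 ∈ₛ primes) ⇒ᶠ (exactᶠ v3 v1 v2 ⇒ᶠ
         ((v3 ^ᵗ v0 ∣ᶠ v2) ⇒ᶠ (v0 ≤ᶠ v1)))))))))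
      λ p n a b pp ex d → exact-bound {p} {n} a b pp (T-does⁻ em ex) d

  exact⇒divides* : ∀ p n a → Exact p a n → p *^ a *∣ n
  exact⇒divides* =
    to (transfer (∀ᶠ ι (∀ᶠ ι (∀ᶠ ι (exactᶠ v2 v0 v1 ⇒ᶠ (v2 ^ᵗ v0 ∣ᶠ v1))))))
      λ p n a ex → exact⇒divides {p} {n} a (T-does⁻ em ex)

  exact-lift* : ∀ p x y a → p ∈′ ⋆ primes → Exact p a x → x *∣ y → ∃[ b ] Exact p b y × a *≤ b
  exact-lift* =
    to (transfer (∀ᶠ ι (∀ᶠ ι (∀ᶠ ι (∀ᶠ ι ((v3 ∈ₛ primes) ⇒ᶠ (exactᶠ v3 v0 v2 ⇒ᶠ
         ((v2 ∣ᶠ v1) ⇒ᶠ ∃ᶠ ι (exactᶠ (var four) v0 v2 ∧ᶠ (v1 ≤ᶠ v0))))))))))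
      λ p x y a pp ex d → let b , ey , le = exact-lift {p} {x} {y} a pp (T-does⁻ em ex) d in
                          b , T-does⁺ em ey , le
    where
    four = there (there (there (there (here refl))))

  𝒰-closed* : ∀ {A} → 𝒰 A → ∀ m n → m ∈′ ⋆ A → m *∣ n → n ∈′ ⋆ A
  𝒰-closed* {A} A∈𝒰 =
    to (transfer (∀ᶠ ι (∀ᶠ ι ((v1 ∈ₛ A) ⇒ᶠ ((v1 ∣ᶠ v0) ⇒ᶠ (v0 ∈ₛ A)))))) (𝒰-closed A∈𝒰)

  *∣⇒∣~ : ∀ m n → m *∣ n → tp m ∣~ tp n
  *∣⇒∣~ m n m∣n A m∈A A∈𝒰 = 𝒰-closed* A∈𝒰 m n m∈A m∣n

  -- All constants of a formula are standard, so `φ` defines a standard subset `⟪ φ ⟫` and its truth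
  -- at `x` is part of the type of `x`.
  tp-Sat : ∀ {x y} → tp x ≋ tp y → (φ : Formula (ι ∷ [])) → Sat (x ∷ []) φ → Sat (y ∷ []) φ
  tp-Sat x≋y φ s = to (∈⟪ φ ⟫) (to (x≋y ⟪ φ ⟫) (from (∈⟪ φ ⟫) s))

-- Equality and divisibility of families.

≋-sym : ∀ {𝓕 𝓖} → 𝓕 ≋ 𝓖 → 𝓖 ≋ 𝓕
≋-sym e A = mk⇔ (from (e A)) (to (e A))

≋-trans : ∀ {𝓕 𝓖 𝓗} → 𝓕 ≋ 𝓖 → 𝓖 ≋ 𝓗 → 𝓕 ≋ 𝓗
≋-trans e f A = mk⇔ (to (f A) ∘ to (e A)) (from (e A) ∘ from (f A))

≋⇒∣~ : ∀ {𝓕 𝓖} → 𝓕 ≋ 𝓖 → 𝓕 ∣~ 𝓖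
≋⇒∣~ e A A∈𝓕 _ = to (e A) A∈𝓕

≋⇒=~ : ∀ {𝓕 𝓖} → 𝓕 ≋ 𝓖 → 𝓕 =~ 𝓖
≋⇒=~ {𝓕} {𝓖} e = ≋⇒∣~ {𝓕} {𝓖} e , ≋⇒∣~ {𝓖} {𝓕} (≋-sym {𝓕} {𝓖} e)

∣~-trans : ∀ {𝓕 𝓖 𝓗} → 𝓕 ∣~ 𝓖 → 𝓖 ∣~ 𝓗 → 𝓕 ∣~ 𝓗
∣~-trans d e A A∈𝓕 A∈𝒰 = e A (d A A∈𝓕 A∈𝒰) A∈𝒰

=~-sym : ∀ {𝓕 𝓖} → 𝓕 =~ 𝓖 → 𝓖 =~ 𝓕
=~-sym (d , e) = e , d

=~-trans : ∀ {𝓕 𝓖 𝓗} → 𝓕 =~ 𝓖 → 𝓖 =~ 𝓗 → 𝓕 =~ 𝓗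
=~-trans {𝓕} {𝓖} {𝓗} (d , e) (d′ , e′) =
  ∣~-trans {𝓕} {𝓖} {𝓗} d d′ , ∣~-trans {𝓗} {𝓖} {𝓕} e′ e

-- Families of conditions indexed by the subsets of `ℕ⁺` are thereby small enough for saturation.
Subset↣ : Extensionality 0ℓ 0ℓ → Subset ↣ (ℕ → Bool)
Subset↣ ext = mk↣ {to = λ A n → A (suc n , [ _ ])} λ eq →
  ext λ { (suc n , _) → cong-app eq n }

-- Types of prime powers and basic classes.

module Classes (em : ExcludedMiddle 0ℓ) (ext : Extensionality 0ℓ 0ℓ)
               (N : NonstandardExtension) (sat : 𝔠⁺-Saturated N) where
  open Arithmetic em N public

  ∈-stable : ∀ {σ} {x : Obj σ} {A : Obj (𝒫 σ)} → ¬ ¬ x ∈′ A → x ∈′ A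
  ∈-stable = decidable-stable (T? _)

  tp-ultrafilter : *ℕ → Ultrafilter
  tp-ultrafilter x = record
    { family = tp x
    ; whole  = to (transfer (∀ᶠ ι (v0 ∈ₛ (λ _ → true)))) (λ _ → _) x
    ; proper = to (transfer (∀ᶠ ι (¬ᶠ (v0 ∈ₛ (λ _ → false))))) (λ _ e → e) x
    ; upward = λ A B A⊆B → to (transfer (∀ᶠ ι ((v0 ∈ₛ A) ⇒ᶠ (v0 ∈ₛ B)))) A⊆B x
    ; meet   = λ A B → to (transfer (∀ᶠ ι ((v0 ∈ₛ A) ⇒ᶠ ((v0 ∈ₛ B) ⇒ᶠ (v0 ∈ₛ (λ n → A n ∧ B n))))))
                         (λ n n∈A n∈B → from T-∧ (n∈A , n∈B)) x
    ; ultra  = λ A → to (transfer (∀ᶠ ι ((v0 ∈ₛ A) ∨ᶠ (v0 ∈ₛ (λ n → not (A n)))))) (λ n → T-not (A n)) x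
    }
    where
    T-not : ∀ a → T a ⊎ T (not a)
    T-not true  = inj₁ _
    T-not false = inj₂ _

  -- If A and B in 𝒰 separated the two types in opposite directions, the exponent e
  -- that tp p ≋ tp q supplies for q with q ^ e in A but not in B would be comparable with b.
  ∣~-linear : ∀ p q a b → tp p ≋ tp q → tp (p *^ a) ∣~ tp (q *^ b) ⊎ tp (q *^ b) ∣~ tp (p *^ a)
  ∣~-linear p q a b p≋q with em {tp (p *^ a) ∣~ tp (q *^ b)}
  ... | yes d = inj₁ d
  ... | no ¬d = inj₂ λ B q∈B B∈𝒰 → ∈-stable λ p∉B →
    ¬d λ A p∈A A∈𝒰 → ∈-stable λ q∉A → separated A B A∈𝒰 B∈𝒰 p∈A p∉B q∈B q∉A
    where
    separated : ∀ A B → 𝒰 A → 𝒰 B → p *^ a ∈′ ⋆ A → ¬ p *^ a ∈′ ⋆ B →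
                q *^ b ∈′ ⋆ B → ¬ q *^ b ∈′ ⋆ A → ⊥
    separated A B A∈𝒰 B∈𝒰 p∈A p∉B q∈B q∉A
      with tp-Sat p≋q (∃ᶠ ι ((v1 ^ᵗ v0 ∈ₛ A) ∧ᶠ (¬ᶠ (v1 ^ᵗ v0 ∈ₛ B)))) (a , p∈A , p∉B)
    ... | e , qe∈A , qe∉B with *≤-total b e
    ...   | inj₁ b≤e = qe∉B (𝒰-closed* B∈𝒰 _ _ q∈B (*^-mono q b e b≤e))
    ...   | inj₂ e≤b = q∉A (𝒰-closed* A∈𝒰 _ _ qe∈A (*^-mono q e b e≤b))

  -- For `A` in the type of `q`, the prime powers with base in `A` form a standard set whose
  -- extension contains `q *^ c`, hence `r *^ d`. A prime power determines its base, so `r` lies in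
  -- `⋆ A` too.
  base-type : ∀ {q r c d} → q ∈′ ⋆ primes → r ∈′ ⋆ primes → tp (q *^ c) ≋ tp (r *^ d) →
              tp q ≋ tp r
  base-type {q} {r} {c} {d} qp rp e A =
    mk⇔ (half qp rp e) (half rp qp (≋-sym {tp (q *^ c)} {tp (r *^ d)} e))
    where
    half : ∀ {q r c d} → q ∈′ ⋆ primes → r ∈′ ⋆ primes → tp (q *^ c) ≋ tp (r *^ d) →
           q ∈′ ⋆ A → r ∈′ ⋆ A
    half {q} {r} {c} {d} qp rp e q∈A
      with m , mp , m∈A , f , eq ← tp-Sat e
             (∃ᶠ ι ((v0 ∈ₛ primes) ∧ᶠ ((v0 ∈ₛ A) ∧ᶠ ∃ᶠ ι (v2 ≐ᶠ v1 ^ᵗ v0)))) (q , qp , q∈A , c , refl)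
      with refl , _ ← *-power∣power m r f d mp rp (subst (_*∣ r *^ d) eq (*∣-refl (r *^ d)))
      = m∈A

  generates⁺ : ∀ B {q c} → BasicClass.u B (q , c) → Generates B (q *^ c)
  generates⁺ B {q} {c} h = tp (q *^ c) , (q , c , h , λ _ → mk⇔ (λ x → x) (λ x → x))
                                       , λ _ → mk⇔ (λ x → x) (λ x → x)

  ⊨𝓟⇒prime : ∀ B {q} → q ⊨ family (𝓟 B) → q ∈′ ⋆ primes
  ⊨𝓟⇒prime B q⊨𝓟 = from (q⊨𝓟 primes) (BasicClass.isPrime B)

  -- `Generates` only provides some pair of the class whose power has the type of `q *^ c`. By
  -- `base-type` its prime has the type of `q`, so `(q , c)` itself belongs to `u`.
  generates⁻ : ∀ B {q c} → q ∈′ ⋆ primes → Generates B (q *^ c) → BasicClass.u B (q , c)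
  generates⁻ B {q} {c} qp (𝓠 , (r , d , (r⊨𝓟 , r~) , 𝓠≋) , q≋) =
    ≋-trans {tp q} {tp r} (base-type {q} {r} {c} {d} qp (⊨𝓟⇒prime B r⊨𝓟) q≋r) r⊨𝓟 ,
    =~-trans {tp (q *^ c)} {tp (r *^ d)} (≋⇒=~ {tp (q *^ c)} {tp (r *^ d)} q≋r) r~
    where
    q≋r : tp (q *^ c) ≋ tp (r *^ d)
    q≋r = ≋-trans {tp (q *^ c)} {𝓠} {tp (r *^ d)} q≋ 𝓠≋

  -- Defines the multiples of the powers `m ^ g m` of primes. By `power∈U` such sets translate the
  -- comparison of an exponent with a standard function of its prime into membership in a set of
  -- `𝒰`, which `∣~` preserves.
  Uᶠ : ⟦ ι ⇒ ι ⟧ → Formula (ι ∷ [])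
  Uᶠ g = ∃ᶠ ι ((v0 ∈ₛ primes) ∧ᶠ (v0 ^ᵗ app (con g) v0 ∣ᶠ v1))

  U : ⟦ ι ⇒ ι ⟧ → Subset
  U g = ⟪ Uᶠ g ⟫

  U∈𝒰 : ∀ g → 𝒰 (U g)
  U∈𝒰 g = 𝒰-intro
    (2⁺ ^⁺ g 2⁺ , ⟪⟫⁺ (Uᶠ g) {2⁺ ^⁺ g 2⁺} (2⁺ , T-does⁺ (prime? 2) prime[2]
                                 , divides⁺ (2⁺ ^⁺ g 2⁺) (2⁺ ^⁺ g 2⁺) ∣-refl))
    (λ m n m∈U m∣n → let p , pp , d = ⟪⟫⁻ (Uᶠ g) {m} m∈U in
      ⟪⟫⁺ (Uᶠ g) {n} (p , pp , divides⁺ (p ^⁺ g p) n (∣-trans (divides⁻ (p ^⁺ g p) m d) (divides⁻ m n m∣n))))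

  power∈U : ∀ g {q c} → q ∈′ ⋆ primes → q *^ c ∈′ ⋆ U g ⇔ ⋆ g · q *≤ c
  power∈U g {q} {c} qp = mk⇔
    (λ h → let m , mp , d = to (∈⟪ Uᶠ g ⟫) h
               m≡q , le = *-power∣power m q (⋆ g · m) c mp qp d
           in subst (λ m → ⋆ g · m *≤ c) m≡q le)
    (λ le → from (∈⟪ Uᶠ g ⟫) (q , qp , *^-mono q (⋆ g · q) c le))

  -- As `A` is closed under multiples, the powers of `m` enter it at most once as the exponent
  -- grows. The function `g` picks the last exponent before entry, with default `1⁺` where there is
  -- none.
  jump : ∀ {A} → 𝒰 A → Σ ⟦ ι ⇒ ι ⟧ λ g → ∀ m e →
         ¬ m *^ e ∈′ ⋆ A → m *^ (e *+ ⋆ 1⁺) ∈′ ⋆ A → ⋆ g · m ≡ e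
  jump {A} A∈𝒰 = g , to (transfer (∀ᶠ ι (∀ᶠ ι ((¬ᶠ (v1 ^ᵗ v0 ∈ₛ A)) ⇒ᶠ
                       ((v1 ^ᵗ (v0 +ᵗ con 1⁺) ∈ₛ A) ⇒ᶠ (app (con g) v1 ≐ᶠ v0)))))) g-jump
    where
    Jump : ℕ⁺ → ℕ⁺ → Set
    Jump m e = ¬ T (A (m ^⁺ e)) × T (A (m ^⁺ (e +⁺ 1⁺)))
    choose : ∀ m → Dec (∃ (Jump m)) → ℕ⁺
    choose m (yes (e , _)) = e
    choose m (no _)        = 1⁺
    g : ℕ⁺ → ℕ⁺
    g m = choose m em
    ≮ : ∀ {m e f} → Jump m e → Jump m f → ¬ value e ℕ.< value f
    ≮ {m} {e} {f} (_ , e∈A) (f∉A , _) e<f = f∉A (𝒰-closed A∈𝒰 (m ^⁺ (e +⁺ 1⁺)) (m ^⁺ f) e∈A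
      (divides⁺ (m ^⁺ (e +⁺ 1⁺)) (m ^⁺ f) (^-mono-∣ (value m)
        (subst (ℕ._≤ value f) (sym (trans (value-+⁺ e 1⁺) (ℕ.+-comm (value e) 1))) e<f))))
    unique : ∀ {m e f} → Jump m e → Jump m f → e ≡ f
    unique {m} {e} {f} je jf =
      ℕ⁺-≡ (ℕ.≤-antisym (ℕ.≮⇒≥ (≮ {m} {f} {e} jf je)) (ℕ.≮⇒≥ (≮ {m} {e} {f} je jf)))
    g-jump : ∀ m e → ¬ T (A (m ^⁺ e)) → T (A (m ^⁺ (e +⁺ 1⁺))) → g m ≡ e
    g-jump m e h h′ with em {∃ (Jump m)}
    ... | yes (f , jf) = unique {m} jf (h , h′)
    ... | no ¬j        = contradiction (e , h , h′) ¬j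

  galaxy-closed : ∀ (S : *ℕ → Set) → (∀ c → S c ⇔ S (c *+ ⋆ 1⁺)) → ∀ c n → S c ⇔ S (c *+ ⋆ n)
  galaxy-closed S step c (suc n , _) = closed n
    where
    closed : ∀ n → S c ⇔ S (c *+ ⋆ (suc n , [ _ ]))
    closed zero    = step c
    closed (suc n) =
      mk⇔ (subst S eq ∘ to (step _) ∘ to (closed n)) (from (closed n) ∘ from (step _) ∘ subst S (sym eq))
      where
      k : ℕ⁺
      k = suc n , [ _ ]
      eq : c *+ ⋆ k *+ ⋆ 1⁺ ≡ c *+ ⋆ (suc (suc n) , [ _ ])
      eq = trans (*+-assoc c (⋆ k) (⋆ 1⁺)) (cong (c *+_) (trans (sym (⋆-+ k 1⁺))
             (cong (λ m → ⋆_ {ι} m) (ℕ⁺-≡ (cong suc (ℕ.+-comm n 1))))))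

  -- Basic classes with two exponents on one prime.

  module _ (B : BasicClass) {p₁ a₁ b₁ : *ℕ} (a₁<b₁ : a₁ *< b₁)
           (u-a : BasicClass.u B (p₁ , a₁)) (u-b : BasicClass.u B (p₁ , b₁)) where
    open BasicClass B using (p; a; p⊨𝓟; u)

    private
      S : *ℕ → *ℕ → Set
      S q c = tp (q *^ c) =~ tp (p *^ a)

      p₁-prime : p₁ ∈′ ⋆ primes
      p₁-prime = ⊨𝓟⇒prime B (proj₁ u-a)

    -- Otherwise U g and U (g + 1) would give g p₁ ≤ a₁ and b₁ < g p₁ + 1.
    not-definable : ∀ {q c} → q ⊨ family (𝓟 B) → S q c → (g : ⟦ ι ⇒ ι ⟧) → ⋆ g · q ≢ c
    not-definable {q} {c} q⊨𝓟 Sc g refl =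
      *<⇒≱ c c (subst (_*≤ c) (g⁺≡ q) (to (power∈U g⁺ q-prime) q∈U⁺)) (*≤-refl c)
      where
      q-prime = ⊨𝓟⇒prime B q⊨𝓟
      g⁺ : ⟦ ι ⇒ ι ⟧
      g⁺ m = g m +⁺ 1⁺
      g⁺≡ : ∀ m → ⋆ g⁺ · m ≡ ⋆ g · m *+ ⋆ 1⁺
      g⁺≡ = to (transfer (∀ᶠ ι (app (con g⁺) v0 ≐ᶠ app (con g) v0 +ᵗ con 1⁺))) λ _ → refl
      g≤a₁ : ⋆ g · p₁ *≤ a₁
      g≤a₁ = to (power∈U g p₁-prime) (proj₂ (proj₂ u-a) (U g) (proj₁ Sc (U g)
               (from (power∈U g q-prime) (*≤-refl c)) (U∈𝒰 g)) (U∈𝒰 g))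
      g⁺≤b₁ : ⋆ g⁺ · p₁ *≤ b₁
      g⁺≤b₁ = subst (_*≤ b₁) (sym (g⁺≡ p₁))
                (*≤-trans _ (a₁ *+ ⋆ 1⁺) b₁ (*+-mono-≤ _ _ (⋆ 1⁺) g≤a₁) a₁<b₁)
      q∈U⁺ : q *^ c ∈′ ⋆ U g⁺
      q∈U⁺ = proj₂ Sc (U g⁺) (proj₁ (proj₂ u-b) (U g⁺)
               (from (power∈U g⁺ p₁-prime) g⁺≤b₁) (U∈𝒰 g⁺)) (U∈𝒰 g⁺)

    -- A set of `𝒰` separating the two powers would, by `jump`, make `c` the value of a standard
    -- function at `q`, and then its successor as well. One of the two is an exponent of the class,
    -- which contradicts `not-definable`.
    S-step : ∀ {q} → q ⊨ family (𝓟 B) → ∀ c → S q c ⇔ S q (c *+ ⋆ 1⁺)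
    S-step {q} q⊨𝓟 c = mk⇔
      (λ Sc → =~-trans {tp (q *^ (c *+ ⋆ 1⁺))} {tp (q *^ c)} (up λ g eq → not-definable q⊨𝓟 Sc g eq) Sc)
      (λ Sc → =~-trans {tp (q *^ c)} {tp (q *^ (c *+ ⋆ 1⁺))}
         (=~-sym {tp (q *^ (c *+ ⋆ 1⁺))} {tp (q *^ c)} (up λ g eq →
            not-definable q⊨𝓟 Sc (λ m → g m +⁺ 1⁺) (trans (g⁺≡ g) (cong (_*+ ⋆ 1⁺) eq)))) Sc)
      where
      g⁺≡ : ∀ g → ⋆_ {ι ⇒ ι} (λ m → g m +⁺ 1⁺) · q ≡ ⋆ g · q *+ ⋆ 1⁺
      g⁺≡ g = to (transfer (∀ᶠ ι (app (con (λ m → g m +⁺ 1⁺)) v0 ≐ᶠ app (con g) v0 +ᵗ con 1⁺)))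
                 (λ _ → refl) q
      up : (∀ (g : ⟦ ι ⇒ ι ⟧) → ⋆ g · q ≢ c) → tp (q *^ (c *+ ⋆ 1⁺)) =~ tp (q *^ c)
      up nd = (λ A h A∈𝒰 → ∈-stable λ h′ → let g , j = jump A∈𝒰 in nd g (j q c h′ h)) ,
              *∣⇒∣~ _ _ (*^-mono q c (c *+ ⋆ 1⁺) (*+-≤ c (⋆ 1⁺)))

    -- The exponent `a` meets all conditions at `p`. That finitely many of them can be met is a
    -- formula about the prime alone, so it holds at `q`, which has the type of `p`; saturation
    -- meets them all at once.
    S-nonempty : ∀ {q} → q ⊨ family (𝓟 B) → ∃ (S q)
    S-nonempty {q} q⊨𝓟 =
      let c , h = saturate sat (Subset↣ ext) (q ∷ []) φ fip in
      c , (λ A qc∈A A∈𝒰 → from (agree h A A∈𝒰) qc∈A) , (λ A pa∈A A∈𝒰 → to (agree h A A∈𝒰) pa∈A)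
      where
      φ : Subset → Formula (ι ∷ ι ∷ [])
      φ A = guard (em {𝒰 A}) (decideᶠ (em {p *^ a ∈′ ⋆ A}) (v1 ^ᵗ v0 ∈ₛ A))
      agree : ∀ {c} → (∀ A → Sat (c ∷ q ∷ []) (φ A)) → ∀ A → 𝒰 A → p *^ a ∈′ ⋆ A ⇔ q *^ c ∈′ ⋆ A
      agree h A A∈𝒰 = to (Sat-decide em) (to (Sat-guard em) (h A) A∈𝒰)
      fip : ∀ is → ∃[ c ] All (λ A → Sat (c ∷ q ∷ []) (φ A)) is
      fip is =
        let c , h = tp-Sat (≋-trans {tp p} {family (𝓟 B)} {tp q} p⊨𝓟
                               (≋-sym {tp q} {family (𝓟 B)} q⊨𝓟)) (∃ᶠ ι (⋀ᶠ φ is))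
                      (a , from (Sat-⋀ φ (a ∷ p ∷ []) is) (All.tabulate λ _ →
                        from (Sat-guard em) λ _ → from (Sat-decide em) (mk⇔ (λ h → h) (λ h → h))))
        in c , to (Sat-⋀ φ (c ∷ q ∷ []) is) h

    -- The fibre serves as its own set of representatives. Its members are infinite by
    -- `not-definable` for constant functions, it absorbs galaxies by `S-step`, and it is convex
    -- because `*^` is monotone for divisibility.
    secondKind : SecondKind B
    secondKind q q⊨𝓟 = fibre B q
      , (let c , Sc = S-nonempty q⊨𝓟 in c , fibre⁺ Sc)
      , (λ c c∈ n eq → not-definable q⊨𝓟 (fibre⁻ c∈) (λ _ → n) (trans (const≡ n) (sym eq)))
      , (λ b → mk⇔ (λ b∈ → b , b∈ , inj₁ refl) (λ (k , k∈ , g) → fibre⁺ (galaxy k b (fibre⁻ k∈) g)))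
      , λ k l m k∈ l∈ k≤m m≤l → m , fibre⁺ (convex k l m (fibre⁻ k∈) (fibre⁻ l∈) k≤m m≤l) , inj₁ refl
      where
      fibre⁺ : ∀ {c} → S q c → fibre B q c
      fibre⁺ Sc = generates⁺ B (q⊨𝓟 , Sc)
      fibre⁻ : ∀ {c} → fibre B q c → S q c
      fibre⁻ c∈ = proj₂ (generates⁻ B (⊨𝓟⇒prime B q⊨𝓟) c∈)
      const≡ : ∀ n → ⋆_ {ι ⇒ ι} (λ _ → n) · q ≡ ⋆ n
      const≡ n = to (transfer (∀ᶠ ι (app (con (λ _ → n)) v0 ≐ᶠ con n))) (λ _ → refl) q
      galaxy : ∀ k b → S q k → Galaxy k b → S q b
      galaxy k .k Sk (inj₁ refl)             = Sk
      galaxy k _ Sk (inj₂ (n , inj₁ refl)) = to (galaxy-closed (S q) (S-step q⊨𝓟) k n) Sk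
      galaxy _ b Sk (inj₂ (n , inj₂ refl)) = from (galaxy-closed (S q) (S-step q⊨𝓟) b n) Sk
      convex : ∀ k l m → S q k → S q l → k *≤ m → m *≤ l → S q m
      convex k l m Sk Sl k≤m m≤l =
        ∣~-trans {tp (q *^ m)} {tp (q *^ l)} {tp (p *^ a)} (*∣⇒∣~ _ _ (*^-mono q m l m≤l)) (proj₁ Sl) ,
        ∣~-trans {tp (p *^ a)} {tp (q *^ k)} {tp (q *^ m)} (proj₂ Sk) (*∣⇒∣~ _ _ (*^-mono q k m k≤m))

-- Finite and unbounded predicates.

_∖_ : {A : Set} → (A → Set) → A → A → Set
(P ∖ x) y = P y × y ≢ x

-- The removed points need not satisfy `P`, so this is only an upper bound; `Exactly` demands that
-- they do.
AtMost : {A : Set} → ℕ → (A → Set) → Set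
AtMost zero    P = ∀ y → ¬ P y
AtMost (suc k) P = ∃[ x ] AtMost k (P ∖ x)

Exactly : {A : Set} → ℕ → (A → Set) → Set
Exactly zero    P = ∀ y → ¬ P y
Exactly (suc k) P = ∃[ x ] P x × Exactly k (P ∖ x)

Unbounded : {A : Set} → (A → Set) → Set
Unbounded P = ∀ k → ¬ AtMost k P

AtMost-mono : ∀ {A : Set} k {P Q : A → Set} → (∀ y → P y → Q y) → AtMost k Q → AtMost k P
AtMost-mono zero    P⊆Q h y p   = h y (P⊆Q y p)
AtMost-mono (suc k) P⊆Q (x , h) = x , AtMost-mono k (λ y (p , ≢x) → P⊆Q y p , ≢x) h

Exactly-resp : ∀ {A : Set} k {P Q : A → Set} → (∀ y → P y ⇔ Q y) → Exactly k P → Exactly k Q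
Exactly-resp zero    e h y q       = h y (from (e y) q)
Exactly-resp (suc k) e (x , p , h) = x , to (e x) p , Exactly-resp k
  (λ y → mk⇔ (λ (p , ≢x) → to (e y) p , ≢x) (λ (q , ≢x) → from (e y) q , ≢x)) h

module Counting (em : ExcludedMiddle 0ℓ) where

  -- When the bound is least, every removal hits `P`, since a wasted one could be dropped.
  Exactly-least : ∀ {A : Set} k {P : A → Set} → AtMost k P → (∀ j → j < k → ¬ AtMost j P) →
                  Exactly k P
  Exactly-least zero    h       _     = h
  Exactly-least (suc k) {P} (x , h) least with em {P x}
  ... | yes p = x , p , Exactly-least k h λ j j<k h′ → least (suc j) (ℕ.s<s j<k) (x , h′)
  ... | no ¬p = contradiction
    (AtMost-mono k (λ y p → p , λ { refl → ¬p p }) h) (least k (ℕ.n<1+n k))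

  index : ∀ {A : Set} k {P : A → Set} → AtMost k P →
          Σ (∀ y → P y → Fin k) λ f → ∀ {y z} p q → f y p ≡ f z q → y ≡ z
  index zero    h = (λ y p → contradiction p (h y)) , λ p → contradiction p (h _)
  index (suc k) {P} (x , h) = (λ y p → f y p em) , λ p q → inj p q em em
    where
    f′ = proj₁ (index k h)
    f : ∀ y → P y → Dec (y ≡ x) → Fin (suc k)
    f y p (yes _)  = zero
    f y p (no y≢x) = suc (f′ y (p , y≢x))
    inj : ∀ {y z} p q d e → f y p d ≡ f z q e → y ≡ z
    inj p q (yes refl) (yes refl) _  = refl
    inj p q (no y≢x)   (no z≢x)   eq = proj₂ (index k h) (p , y≢x) (q , z≢x) (suc-injective eq)

  enumeration : ∀ {A : Set} k {P : A → Set} → Exactly k P →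
    Σ (Fin k → A) λ f → (∀ i → P (f i)) × (∀ {i j} → f i ≡ f j → i ≡ j) × (∀ y → P y → ∃[ i ] f i ≡ y)
  enumeration zero    h = (λ ()) , (λ ()) , (λ { {()} }) , λ y p → contradiction p (h y)
  enumeration {A} (suc k) {P} (x , px , h) with f , f∈ , f-inj , f-surj ← enumeration k h =
    x Vector.∷ f , ∈P , (λ {i} {j} → inj {i} {j}) , λ y p → surj y p em
    where
    ∈P : ∀ i → P ((x Vector.∷ f) i)
    ∈P zero    = px
    ∈P (suc i) = proj₁ (f∈ i)
    inj : ∀ {i j} → (x Vector.∷ f) i ≡ (x Vector.∷ f) j → i ≡ j
    inj {zero}  {zero}  _  = refl
    inj {zero}  {suc j} eq = contradiction (sym eq) (proj₂ (f∈ j))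
    inj {suc i} {zero}  eq = contradiction eq (proj₂ (f∈ i))
    inj {suc i} {suc j} eq = cong suc (f-inj eq)
    surj : ∀ y → P y → Dec (y ≡ x) → ∃[ i ] (x Vector.∷ f) i ≡ y
    surj y p (yes refl) = zero , refl
    surj y p (no y≢x)   = let i , eq = f-surj y (p , y≢x) in suc i , eq

  Exactly⇒AtMost : ∀ {A : Set} k {P : A → Set} → Exactly k P → AtMost k P
  Exactly⇒AtMost zero    h           = h
  Exactly⇒AtMost (suc k) (x , _ , h) = x , Exactly⇒AtMost k h

  Exactly-↔ : ∀ {A : Set} k {P : A → Set} → Exactly k P → Refinement A P ↔ Fin k
  Exactly-↔ k {P} h with f , f∈ , f-inj , f-surj ← enumeration k h = mk↔ₛ′
    (λ (y , [ p ]) → proj₁ (f-surj y (recompute em p)))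
    (λ i → f i , [ f∈ i ])
    (λ i → f-inj (proj₂ (f-surj (f i) _)))
    (λ (y , [ p ]) → value-injective (proj₂ (f-surj y _)))

  -- Pigeonhole: an element of `Q` outside `P`, put in front of the `k` elements of `P`, would give
  -- `k + 1` distinct elements of `Q`.
  Exactly-⊆ : ∀ {A : Set} k {P Q : A → Set} → Exactly k P → Exactly k Q → (∀ y → P y → Q y) →
              ∀ y → Q y → P y
  Exactly-⊆ {A} k {P} {Q} hp hq P⊆Q y q
    with f , f∈ , f-inj , _ ← enumeration k hp | g , g-inj ← index k (Exactly⇒AtMost k hq) =
    decidable-stable em λ ¬p →
      let i , j , i<j , eq = pigeonhole (ℕ.n<1+n k) (λ i → g ((y Vector.∷ f) i) (∈Q i))
      in contradiction (inj ¬p i j (g-inj _ _ eq)) (<⇒≢ i<j)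
    where
    ∈Q : ∀ i → Q ((y Vector.∷ f) i)
    ∈Q zero    = q
    ∈Q (suc i) = P⊆Q _ (f∈ i)
    inj : ¬ P y → ∀ i j → (y Vector.∷ f) i ≡ (y Vector.∷ f) j → i ≡ j
    inj ¬p zero    zero    _    = refl
    inj ¬p zero    (suc j) refl = contradiction (f∈ j) ¬p
    inj ¬p (suc i) zero    refl = contradiction (f∈ i) ¬p
    inj ¬p (suc i) (suc j) eq   = cong suc (f-inj eq)

  fresh : ∀ {A : Set} {P : A → Set} → Unbounded P → ∀ n (ρ : Vector A n) →
          ∃[ y ] P y × (∀ i → ρ i ≢ y)
  fresh {A} {P} unb n ρ = case em {∃[ y ] P y × (∀ i → ρ i ≢ y)} of λ
    { (yes h) → h
    ; (no ¬h) → contradiction (cover n ρ (λ y p → decidable-stable em λ ¬i →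
                  ¬h (y , p , λ i eq → ¬i (i , eq)))) (unb n) }
    where
    cover : ∀ n {P : A → Set} (ρ : Vector A n) → (∀ y → P y → ∃[ i ] ρ i ≡ y) → AtMost n P
    cover zero    ρ h y p = case proj₁ (h y p) of λ ()
    cover (suc n) ρ h     = ρ zero , cover n (ρ ∘ suc) λ y (p , y≢) → case h y p of λ
      { (zero , eq)  → contradiction (sym eq) y≢
      ; (suc i , eq) → i , eq }

  -- The Cantor-Schröder-Bernstein theorem.

  module _ {A B : Set} (f : A → B) (g : B → A)
           (f-inj : Injective _≡_ _≡_ f) (g-inj : Injective _≡_ _≡_ g) where

    private
      -- The points whose backward orbit under f and g stops in A.
      data C : A → Set where
        start : ∀ {a} → (∀ b → g b ≢ a) → C a
        next  : ∀ {a} → C a → C (g (f a))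

      C-inv : ∀ {a b} → C a → a ≡ g b → ∃[ a′ ] C a′ × f a′ ≡ b
      C-inv (start h) eq = contradiction (sym eq) (h _)
      C-inv (next c)  eq = _ , c , g-inj eq

      g⁻¹ : ∀ {a} → ¬ C a → ∃[ b ] g b ≡ a
      g⁻¹ ¬c = decidable-stable em λ h → ¬c (start λ b eq → h (b , eq))

      h : ∀ a → Dec (C a) → B
      h a (yes _) = f a
      h a (no ¬c) = proj₁ (g⁻¹ ¬c)

      h-inj : ∀ {a a′} d d′ → h a d ≡ h a′ d′ → a ≡ a′
      h-inj (yes _) (yes _)  eq = f-inj eq
      h-inj (yes c) (no ¬c′) eq = contradiction
        (subst C (trans (cong g eq) (proj₂ (g⁻¹ ¬c′))) (next c)) ¬c′
      h-inj (no ¬c) (yes c′) eq = contradiction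
        (subst C (trans (cong g (sym eq)) (proj₂ (g⁻¹ ¬c))) (next c′)) ¬c
      h-inj (no ¬c) (no ¬c′) eq =
        trans (sym (proj₂ (g⁻¹ ¬c))) (trans (cong g eq) (proj₂ (g⁻¹ ¬c′)))

      h-yes : ∀ {a} d → C a → h a d ≡ f a
      h-yes (yes _) _ = refl
      h-yes (no ¬c) c = contradiction c ¬c

      h-no : ∀ {b} d → ¬ C (g b) → h (g b) d ≡ b
      h-no (yes c) ¬c = contradiction c ¬c
      h-no (no ¬c) _  = g-inj (proj₂ (g⁻¹ ¬c))

      h-surj : ∀ b → ∃[ a ] h a em ≡ b
      h-surj b with em {C (g b)}
      ... | yes c = let a , ca , eq = C-inv c refl in a , trans (h-yes em ca) eq
      ... | no ¬c = g b , h-no em ¬c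

    cantor-schröder-bernstein : A ↔ B
    cantor-schröder-bernstein = ⤖⇒↔ (mk⤖ {to = λ a → h a em}
      (h-inj em em , strictlySurjective⇒surjective h-surj))

-- Infinite structures for the empty language.

∅ᴸ : Language
∅ᴸ = record { #rel = 0 ; #fun = 0 ; relArity = λ () ; funArity = λ () }

module _ (em : ExcludedMiddle 0ℓ) where
  open FOStructure using (Carrier; SatFO)

  -- Back and forth: formulas of the empty language see only which entries of an assignment
  -- coincide, and fresh elements allow such a pattern to be extended on either side.
  infinite-equivalent : (M M′ : FOStructure ∅ᴸ) →
    (∀ n (ρ : Vector (Carrier M) n) → ∃[ y ] ∀ i → ρ i ≢ y) →
    (∀ n (ρ : Vector (Carrier M′) n) → ∃[ y ] ∀ i → ρ i ≢ y) →
    ElementarilyEquivalent ∅ᴸ M M′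
  infinite-equivalent M M′ fresh fresh′ φ = equiv φ Vector.[] Vector.[] λ ()
    where
    SamePattern : ∀ {n} → Vector (Carrier M) n → Vector (Carrier M′) n → Set
    SamePattern ρ ρ′ = ∀ i j → ρ i ≡ ρ j ⇔ ρ′ i ≡ ρ′ j

    extend : ∀ {A B : Set} {n} (ρ : Vector A n) (ρ′ : Vector B n) →
      (∀ n (ρ : Vector A n) → ∃[ y ] ∀ i → ρ i ≢ y) →
      (∀ i j → ρ i ≡ ρ j ⇔ ρ′ i ≡ ρ′ j) → ∀ y → ∃[ x ] (∀ i j →
        (x Vector.∷ ρ) i ≡ (x Vector.∷ ρ) j ⇔ (y Vector.∷ ρ′) i ≡ (y Vector.∷ ρ′) j)
    extend {n = n} ρ ρ′ fr same y with em {∃[ i ] ρ′ i ≡ y}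
    ... | yes (k , refl) = ρ k , λ
      { zero    zero    → mk⇔ (λ _ → refl) (λ _ → refl)
      ; zero    (suc j) → same k j
      ; (suc i) zero    → same i k
      ; (suc i) (suc j) → same i j }
    ... | no y∉ with x , x∉ ← fr n ρ = x , λ
      { zero    zero    → mk⇔ (λ _ → refl) (λ _ → refl)
      ; zero    (suc j) → mk⇔ (λ eq → contradiction (sym eq) (x∉ j)) (λ eq → contradiction (j , sym eq) y∉)
      ; (suc i) zero    → mk⇔ (λ eq → contradiction eq (x∉ i)) (λ eq → contradiction (i , eq) y∉)
      ; (suc i) (suc j) → same i j }

    flip : ∀ {n} {ρ : Vector (Carrier M) n} {ρ′} → SamePattern ρ ρ′ → ∀ i j → ρ′ i ≡ ρ′ j ⇔ ρ i ≡ ρ j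
    flip same i j = mk⇔ (from (same i j)) (to (same i j))

    equiv : ∀ {n} (φ : FOFormula ∅ᴸ n) ρ ρ′ → SamePattern ρ ρ′ → SatFO M ρ φ ⇔ SatFO M′ ρ′ φ
    equiv falsum ρ ρ′ same = mk⇔ (λ x → x) (λ x → x)
    equiv (equal (var i) (var j)) ρ ρ′ same = same i j
    equiv (imp φ ψ) ρ ρ′ same = mk⇔
      (λ s t → to (equiv ψ ρ ρ′ same) (s (from (equiv φ ρ ρ′ same) t)))
      (λ s t → from (equiv ψ ρ ρ′ same) (s (to (equiv φ ρ ρ′ same) t)))
    equiv (all φ) ρ ρ′ same = mk⇔
      (λ s y → let x , same⁺ = extend ρ ρ′ fresh same y in
               to (equiv φ (x Vector.∷ ρ) (y Vector.∷ ρ′) same⁺) (s x))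
      (λ s x → let y , same⁺ = extend ρ′ ρ fresh′ (flip same) x in
               from (equiv φ (x Vector.∷ ρ) (y Vector.∷ ρ′) (λ i j → mk⇔ (from (same⁺ i j)) (to (same⁺ i j)))) (s y))

-- Cardinalities of internal sets.

module Cardinality (em : ExcludedMiddle 0ℓ) (N : NonstandardExtension)
                   (hip : HensonIsomorphismProperty N) where
  open Arithmetic em N
  open Counting em

  Elements : ∀ {σ} → Obj (𝒫 σ) → Set
  Elements {σ} s = Σ (Obj σ) (_∈′ s)

  element-≡ : ∀ {σ} {s : Obj (𝒫 σ)} {x y : Elements s} → proj₁ x ≡ proj₁ y → x ≡ y
  element-≡ {x = x , p} {.x , q} refl = cong (x ,_) (T-prop p q)

  presentation : ∀ {σ} (s : Obj (𝒫 σ)) → Unbounded (_∈′ s) → InternallyPresented N ∅ᴸ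
  presentation {σ} s unb = record
    { sort     = σ
    ; universe = s
    ; nonempty = let x , x∈s , _ = fresh unb 0 (λ ()) in x , x∈s
    ; relation = λ ()
    ; function = λ ()
    ; closed   = λ ()
    }

  -- Over the empty language an isomorphism is a bare bijection, and unboundedness supplies the
  -- fresh elements needed for elementary equivalence.
  unbounded-↔ : ∀ {σ τ} {s : Obj (𝒫 σ)} {t : Obj (𝒫 τ)} → Unbounded (_∈′ s) → Unbounded (_∈′ t) →
                Elements s ↔ Elements t
  unbounded-↔ {s = s} {t} us ut = Isomorphism.bijection
    (hip ∅ᴸ (presentation s us) (presentation t ut)
      (infinite-equivalent em _ _ (freshElement us) (freshElement ut)))
    where
    freshElement : ∀ {σ} {s : Obj (𝒫 σ)} → Unbounded (_∈′ s) →
                   ∀ n (ρ : Vector (Elements s) n) → ∃[ y ] ∀ i → ρ i ≢ y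
    freshElement unb n ρ = let y , y∈s , y∉ = fresh unb n (proj₁ ∘ ρ) in
                           (y , y∈s) , λ i eq → y∉ i (cong proj₁ eq)

  ⋆-injective : ∀ {m n : ℕ⁺} → ⋆ m ≡ ⋆ n → m ≡ n
  ⋆-injective {m} {n} = from (transfer (con m ≐ᶠ con n))

  ⋆≤infinite : ∀ {z} → Infinite z → ∀ n → ⋆_ {ι} (suc n , [ _ ]) *≤ z
  ⋆≤infinite {z} inf zero = to (transfer (∀ᶠ ι (con 1⁺ ≤ᶠ v0))) (λ n → atMost⁺ 1⁺ n (value≥1 n)) z
  ⋆≤infinite {z} inf (suc n) with *≤⇒≡⊎< (⋆ (suc n , [ _ ])) z (⋆≤infinite inf n)
  ... | inj₁ eq = contradiction (sym eq) (inf _)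
  ... | inj₂ lt = subst (_*≤ z)
    (trans (sym (⋆-+ (suc n , [ _ ]) 1⁺)) (cong (λ m → ⋆_ {ι} m) (ℕ⁺-≡ (cong suc (ℕ.+-comm n 1))))) lt

  initialSegment : *ℕ → Obj (𝒫 ι)
  initialSegment z = proj₁ (comprehension (v0 ≤ᶠ v1) (z ∷ []))

  ∈initialSegment : ∀ {z a} → a ∈′ initialSegment z ⇔ a *≤ z
  ∈initialSegment {z} = proj₂ (comprehension (v0 ≤ᶠ v1) (z ∷ []))

  initialSegment-unbounded : ∀ {z} → Infinite z → Unbounded (_∈′ initialSegment z)
  initialSegment-unbounded {z} inf k h
    with f , f-inj ← index k h
    -- The standard numbers from 1 to `k + 1` all lie below `z`.
    with i , j , i<j , eq ← pigeonhole (ℕ.n<1+n k) (λ i → f (⋆ (suc (toℕ i) , [ _ ]))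
                              (from ∈initialSegment (⋆≤infinite inf (toℕ i))))
    = contradiction (toℕ-injective (ℕ.suc-injective (cong value (⋆-injective (f-inj _ _ eq))))) (<⇒≢ i<j)

  -- Unbounded internal sets are equinumerous, so Cantor–Schröder–Bernstein also counts the external O.
  sandwiched-cardinality : ∀ {σ} (O : Obj σ → Set) (s t : Obj (𝒫 σ)) → Unbounded (_∈′ s) →
    (∀ y → y ∈′ s → O y) → (∀ y → O y → y ∈′ t) → HasCardinality O ∞
  sandwiched-cardinality {σ} O s t unb s⊆O O⊆t z inf =
    cantor-schröder-bernstein f g f-inj g-inj
    where
    I = initialSegment z
    I-unb = initialSegment-unbounded inf
    e₁ : Elements t ↔ Elements I
    e₁ = unbounded-↔ (λ k h → unb k (AtMost-mono k (λ y y∈s → O⊆t y (s⊆O y y∈s)) h)) I-unb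
    e₂ : Elements I ↔ Elements s
    e₂ = unbounded-↔ I-unb unb
    f : Refinement (Obj σ) O → [ a ∈ *ℕ ∣ a *≤ z ]
    f (y , [ o ]) = let a , a∈I = Inverse.to e₁ (y , O⊆t y (recompute em o)) in
                    a , [ to ∈initialSegment a∈I ]
    g : [ a ∈ *ℕ ∣ a *≤ z ] → Refinement (Obj σ) O
    g (a , [ a≤z ]) = let y , y∈s = Inverse.to e₂ (a , from ∈initialSegment (recompute (T? _) a≤z)) in
                      y , [ s⊆O y y∈s ]
    f-inj : Injective _≡_ _≡_ f
    f-inj eq = value-injective (cong proj₁ (Injection.injective (↔⇒↣ e₁) (element-≡ (cong value eq))))
    g-inj : Injective _≡_ _≡_ g
    g-inj eq = value-injective (cong proj₁ (Injection.injective (↔⇒↣ e₂) (element-≡ (cong value eq))))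

-- Multiplicities of basic classes.

Subset×ℕ↣ : Extensionality 0ℓ 0ℓ → (Subset × ℕ) ↣ (ℕ → Bool)
Subset×ℕ↣ ext = mk↣ {to = λ (A , k) → code A k} (λ {x} {y} → code-injective (proj₂ x) (proj₂ y))
  where
  open Injection (Subset↣ ext) using () renaming (to to bits; injective to bits-injective)
  -- The number is written in unary, closed by `false`, in front of the bits of the subset.
  code : Subset → ℕ → ℕ → Bool
  code A zero    zero    = false
  code A zero    (suc n) = bits A n
  code A (suc k) zero    = true
  code A (suc k) (suc n) = code A k n
  code-injective : ∀ {A B} k l → code A k ≡ code B l → (A , k) ≡ (B , l)
  code-injective zero    zero    eq = cong (_, zero) (bits-injective (ext λ n → cong-app eq (suc n)))
  code-injective zero    (suc l) eq = case cong-app eq 0 of λ ()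
  code-injective (suc k) zero    eq = case cong-app eq 0 of λ ()
  code-injective (suc k) (suc l) eq =
    cong (λ (A , k) → A , suc k) (code-injective k l (ext λ n → cong-app eq (suc n)))

-- The sets left after each removal become quantified internal sets, which exist by comprehension; a
-- finite bound on an internal set is thus a formula.
AtMostᶠ : ℕ → ∀ {Γ σ} → Formula (𝒫 σ ∷ Γ)
AtMostᶠ zero    {σ = σ} = ∀ᶠ σ (¬ᶠ (v0 ∈ᶠ v1))
AtMostᶠ (suc k) {σ = σ} = ∃ᶠ σ (∃ᶠ (𝒫 σ)
  (∀ᶠ σ ((v0 ∈ᶠ v1) ⇔ᶠ ((v0 ∈ᶠ v3) ∧ᶠ (¬ᶠ (v0 ≐ᶠ v2)))) ∧ᶠ AtMostᶠ k))

module Multiplicities (em : ExcludedMiddle 0ℓ) (ext : Extensionality 0ℓ 0ℓ)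
                      (N : NonstandardExtension) (sat : 𝔠⁺-Saturated N)
                      (hip : HensonIsomorphismProperty N) where
  open Classes em ext N sat public
  open Counting em
  open Cardinality em N hip

  Sat-AtMost : ∀ k {Γ σ} {s : Obj (𝒫 σ)} {ρ : All Obj Γ} →
               Sat (s ∷ ρ) (AtMostᶠ k) ⇔ AtMost k (_∈′ s)
  Sat-AtMost zero = mk⇔ (λ h → h) (λ h → h)
  Sat-AtMost (suc k) {s = s} {ρ} = mk⇔
    (λ (x , t , e , h) → x , AtMost-mono k (λ y → proj₂ (e y)) (to (Sat-AtMost k) h))
    (λ (x , h) → let t , e = comprehension ((v0 ∈ᶠ v2) ∧ᶠ (¬ᶠ (v0 ≐ᶠ v1))) (x ∷ s ∷ []) in
      x , t , (λ y → to e , from e) , from (Sat-AtMost k) (AtMost-mono k (λ y → to e) h))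

  π₁-pair : ∀ {σ τ} (x : Obj σ) (y : Obj τ) → π₁ ⟨ x , y ⟩ ≡ x
  π₁-pair {σ} {τ} = to (transfer (∀ᶠ σ (∀ᶠ τ (fst (pair v1 v0) ≐ᶠ v1)))) λ _ _ → refl

  π₂-pair : ∀ {σ τ} (x : Obj σ) (y : Obj τ) → π₂ ⟨ x , y ⟩ ≡ y
  π₂-pair {σ} {τ} = to (transfer (∀ᶠ σ (∀ᶠ τ (snd (pair v1 v0) ≐ᶠ v0)))) λ _ _ → refl

  pair-π : ∀ {σ τ} (x : Obj (σ ⊗ τ)) → ⟨ π₁ x , π₂ x ⟩ ≡ x
  pair-π {σ} {τ} = to (transfer (∀ᶠ (σ ⊗ τ) (pair (fst v0) (snd v0) ≐ᶠ v0))) λ _ → refl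

  unpair : ∀ {σ τ} → Obj (σ ⊗ τ) → Obj σ × Obj τ
  unpair x = π₁ x , π₂ x

  unpair-pair : ∀ {σ τ} (x : Obj σ × Obj τ) → unpair ⟨ proj₁ x , proj₂ x ⟩ ≡ x
  unpair-pair (x , y) = cong₂ _,_ (π₁-pair x y) (π₂-pair x y)

  -- Internal sets contain objects of type `σ ⊗ τ`, whereas occurrences are pairs of objects;
  -- cardinalities have to be moved between the two.
  pairs-↔ : ∀ {σ τ} (S : Obj σ × Obj τ → Set) →
            Refinement (Obj σ × Obj τ) S ↔ Refinement (Obj (σ ⊗ τ)) (S ∘ unpair)
  pairs-↔ S = mk↔ₛ′
    (λ ((x , y) , [ s ]) → ⟨ x , y ⟩ , [ subst S (sym (unpair-pair (x , y))) s ])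
    (λ (x , [ s ]) → unpair x , [ s ])
    (λ (x , _) → value-injective (pair-π x))
    (λ (x , _) → value-injective (unpair-pair x))

  module _ (B : BasicClass) where
    open BasicClass B using (p; a; u)

    Occ : *ℕ → Obj (ι ⊗ ι) → Set
    Occ x = Occurrences x B ∘ unpair

    power′ : Obj (ι ⊗ ι) → *ℕ
    power′ y = π₁ y *^ π₂ y

    -- u is the intersection over all A of the internal sets Cond A.
    Cond : Subset → Obj (ι ⊗ ι) → Set
    Cond A y = (T (family (𝓟 B) A) ⇔ π₁ y ∈′ ⋆ A) × (𝒰 A → p *^ a ∈′ ⋆ A ⇔ power′ y ∈′ ⋆ A)

    Condᶠ : ∀ {Γ} → Term Γ (ι ⊗ ι) → Subset → Formula Γ
    Condᶠ t A = decideᶠ (em {T (family (𝓟 B) A)}) (fst t ∈ₛ A) ∧ᶠ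
                guard (em {𝒰 A}) (decideᶠ (em {p *^ a ∈′ ⋆ A}) (fst t ^ᵗ snd t ∈ₛ A))

    Sat-Cond : ∀ {Γ} {t : Term Γ (ι ⊗ ι)} {A ρ} → Sat ρ (Condᶠ t A) ⇔ Cond A (eval ρ t)
    Sat-Cond = mk⇔
      (λ (s , s′) → to (Sat-decide em) s , λ A∈𝒰 → to (Sat-decide em) (to (Sat-guard em) s′ A∈𝒰))
      (λ (c , c′) → from (Sat-decide em) c , from (Sat-guard em) λ A∈𝒰 → from (Sat-decide em) (c′ A∈𝒰))

    u⇔Cond : ∀ y → u (unpair y) ⇔ (∀ A → Cond A y)
    u⇔Cond y = mk⇔
      (λ (q⊨𝓟 , d , e) A → mk⇔ (from (q⊨𝓟 A)) (to (q⊨𝓟 A)) ,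
                            λ A∈𝒰 → mk⇔ (λ h → e A h A∈𝒰) (λ h → d A h A∈𝒰))
      (λ c → (λ A → mk⇔ (from (proj₁ (c A))) (to (proj₁ (c A)))) ,
             (λ A h A∈𝒰 → from (proj₂ (c A) A∈𝒰) h) , λ A h A∈𝒰 → to (proj₂ (c A) A∈𝒰) h)

    -- An internal outer approximation of `Occ x`, from finitely many of the conditions that cut out
    -- the class.
    Approx : List Subset → *ℕ → Obj (ι ⊗ ι) → Set
    Approx K x y = All (λ A → Cond A y) K × Exact (π₁ y) (π₂ y) x

    Approxᶠ : ∀ {Γ} → List Subset → Term Γ ι → Term Γ (ι ⊗ ι) → Formula Γ
    Approxᶠ K x y = ⋀ᶠ (Condᶠ y) K ∧ᶠ exactᶠ (fst y) (snd y) x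

    Sat-Approx : ∀ {Γ} K (x : Term Γ ι) (y : Term Γ (ι ⊗ ι)) {ρ} →
                 Sat ρ (Approxᶠ K x y) ⇔ Approx K (eval ρ x) (eval ρ y)
    Sat-Approx K x y {ρ} = mk⇔
      (λ (s , e) → All.map (to Sat-Cond) (to (Sat-⋀ (Condᶠ y) ρ K) s) , e)
      (λ (c , e) → from (Sat-⋀ (Condᶠ y) ρ K) (All.map (from Sat-Cond) c) , e)

    approximation : ∀ K x → Σ (Obj (𝒫 (ι ⊗ ι))) λ s → ∀ {y} → y ∈′ s ⇔ Approx K x y
    approximation K x = let s , e = comprehension (Approxᶠ K v1 v0) (x ∷ []) in
      s , mk⇔ (to (Sat-Approx K v1 v0) ∘ to e) (from e ∘ from (Sat-Approx K v1 v0))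

    Occ⇒Approx : ∀ {x} K y → Occ x y → Approx K x y
    Occ⇒Approx K y (prime , gen , exact) =
      All.tabulate (λ {A} _ → to (u⇔Cond y) (generates⁻ B prime gen) A) , from Exact⇔ExactPower exact

    Approx⇒Occ : ∀ {x} y → (∀ A → Approx (A ∷ []) x y) → Occ x y
    Approx⇒Occ y h = ⊨𝓟⇒prime B (proj₁ uy) , generates⁺ B uy , to Exact⇔ExactPower (proj₂ (h (λ _ → true)))
      where
      uy = from (u⇔Cond y) λ A → All.head (proj₁ (h A))

    -- The nonstandard `p` and `a` enter `Condᶠ` only through decisions, so the truth of this
    -- formula at `x` depends on the type of `x` alone. Hence size bounds can be read off from `F`.
    fewᶠ : List Subset → ℕ → Formula (ι ∷ [])
    fewᶠ K k = ∃ᶠ (𝒫 (ι ⊗ ι)) (∀ᶠ (ι ⊗ ι) ((v0 ∈ᶠ v1) ⇔ᶠ Approxᶠ K v2 v0) ∧ᶠ AtMostᶠ k)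

    Sat-few : ∀ K k x → Sat (x ∷ []) (fewᶠ K k) ⇔ AtMost k (Approx K x)
    Sat-few K k x = mk⇔
      (λ (s , e , h) → AtMost-mono k (λ y → proj₂ (e y) ∘ from (Sat-Approx K v2 v0)) (to (Sat-AtMost k) h))
      (λ h → let s , e = approximation K x in
        s , (λ y → from (Sat-Approx K v2 v0) ∘ to e , from e ∘ to (Sat-Approx K v2 v0)) ,
        from (Sat-AtMost k) (AtMost-mono k (λ y → to e) h))

    module _ (F : Ultrafilter) where

      Few : ℕ → Set
      Few k = ∃[ K ] T (family F ⟪ fewᶠ K k ⟫)

      few⇔ : ∀ {x} → x ⊨ family F → ∀ K k → T (family F ⟪ fewᶠ K k ⟫) ⇔ AtMost k (Approx K x)
      few⇔ {x} x⊨F K k = mk⇔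
        (to (Sat-few K k x) ∘ to ∈⟪ fewᶠ K k ⟫ ∘ from (x⊨F ⟪ fewᶠ K k ⟫))
        (to (x⊨F ⟪ fewᶠ K k ⟫) ∘ from ∈⟪ fewᶠ K k ⟫ ∘ from (Sat-few K k x))

      least : ∀ k → Few k → ∃[ k ] Few k × ∀ j → j < k → ¬ Few j
      least = <-rec (λ k → Few k → ∃[ k ] Few k × ∀ j → j < k → ¬ Few j) λ k rec few →
        case em {∃[ j ] j < k × Few j} of λ
          { (yes (j , j<k , few′)) → rec j<k few′
          ; (no ¬few)              → k , few , λ j j<k few′ → ¬few (j , j<k , few′) }

      -- For minimal k no further condition can remove an element of Approx K x.
      finite-multiplicity : ∀ {k} → Few k → (∀ j → j < k → ¬ Few j) →
                            ∀ x → x ⊨ family F → Exactly k (Occ x)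
      finite-multiplicity {k} (K , few) ¬few x x⊨F =
        Exactly-resp k (λ y → mk⇔ (λ h → Approx⇒Occ y (single y h)) (Occ⇒Approx K y)) exactly
        where
        atMost′ = to (few⇔ x⊨F K k) few
        exactly : Exactly k (Approx K x)
        exactly = Exactly-least k atMost′ λ j j<k h → ¬few j j<k (K , from (few⇔ x⊨F K j) h)
        drop : ∀ A y → Approx (A ∷ K) x y → Approx K x y
        drop A y (_ ∷ cs , e) = cs , e
        exactly⁺ : ∀ A → Exactly k (Approx (A ∷ K) x)
        exactly⁺ A = Exactly-least k (AtMost-mono k (drop A) atMost′)
          λ j j<k h → ¬few j j<k (A ∷ K , from (few⇔ x⊨F (A ∷ K) j) h)
        single : ∀ y → Approx K x y → ∀ A → Approx (A ∷ []) x y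
        single y h A =
          let cs , e = Exactly-⊆ k {Approx (A ∷ K) x} {Approx K x} (exactly⁺ A) exactly (drop A) y h
          in All.head cs ∷ [] , e

      -- As all approximations are unbounded, saturation yields one internal `s` that obeys every
      -- condition and exceeds every finite size. The occurrences then lie between `s` and the
      -- internal set `t` of all exact pairs of `x`.
      infinite-multiplicity : ¬ (∃ Few) → Multiplicity F B ∞
      infinite-multiplicity ¬few x x⊨F z inf =
        sandwiched-cardinality (Occ x) s t s-unb s⊆Occ Occ⊆t z inf ↔-∘ pairs-↔ (Occurrences x B)
        where
        unb : ∀ K → Unbounded (Approx K x)
        unb K k h = ¬few (k , K , from (few⇔ x⊨F K k) h)
        φ : Subset × ℕ → Formula (𝒫 (ι ⊗ ι) ∷ ι ∷ [])
        φ (A , k) = ∀ᶠ (ι ⊗ ι) ((v0 ∈ᶠ v1) ⇒ᶠ Approxᶠ (A ∷ []) v2 v0) ∧ᶠ (¬ᶠ (AtMostᶠ k))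
        fip : ∀ is → ∃[ s ] All (λ i → Sat (s ∷ x ∷ []) (φ i)) is
        fip is =
          -- One approximation by all the listed subsets meets finitely many demands together.
          let K = map proj₁ is
              s , e = approximation K x
          in s , All.tabulate λ { {A , k} i∈is →
               (λ y y∈s → let c , ex = to e y∈s in
                 from (Sat-Approx (A ∷ []) v2 v0) (All.lookup (map⁻ c) i∈is ∷ [] , ex)) ,
               λ h → unb K k (AtMost-mono k (λ y → from e) (to (Sat-AtMost k) h)) }
        saturated = saturate sat (Subset×ℕ↣ ext) (x ∷ []) φ fip
        s = proj₁ saturated
        s-unb : Unbounded (_∈′ s)
        s-unb k h = proj₂ (proj₂ saturated ((λ _ → true) , k)) (from (Sat-AtMost k) h)
        s⊆Occ : ∀ y → y ∈′ s → Occ x y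
        s⊆Occ y y∈s = Approx⇒Occ y λ A → to (Sat-Approx (A ∷ []) v2 v0) (proj₁ (proj₂ saturated (A , 0)) y y∈s)
        t = proj₁ (approximation [] x)
        Occ⊆t : ∀ y → Occ x y → y ∈′ t
        Occ⊆t y o = from (proj₂ (approximation [] x)) (Occ⇒Approx [] y o)

      multiplicity-dichotomy :
        (∃[ k ] ∀ x → x ⊨ family F → Exactly k (Occ x)) ⊎ Multiplicity F B ∞
      multiplicity-dichotomy = case em {∃ Few} of λ
        { (yes (k , few)) → let k , few , ¬few = least k few in inj₁ (k , finite-multiplicity few ¬few)
        ; (no ¬few)       → inj₂ (infinite-multiplicity ¬few) }

      Exactly⇒Multiplicity : ∀ {k} → (∀ x → x ⊨ family F → Exactly k (Occ x)) → Multiplicity F B (fin k)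
      Exactly⇒Multiplicity h x x⊨F = Exactly-↔ _ (h x x⊨F) ↔-∘ pairs-↔ (Occurrences x B)

-- Interleaving two equivalent ultrafilters.

module Ultrafilters (em : ExcludedMiddle 0ℓ) where
  open Ultrafilter using (whole; proper; upward; meet; ultra)

  large⇒inhabited : ∀ F A → T (family F A) → ∃[ n ] T (A n)
  large⇒inhabited F A A∈F = decidable-stable em λ ∄ →
    proper F (upward F A _ (λ n n∈A → ∄ (n , n∈A)) A∈F)

  upClosure : Subset → Subset
  upClosure A n = does (em {n ∈↑ A})

  upClosure∈𝒰 : ∀ {A} → ∃[ n ] T (A n) → 𝒰 (upClosure A)
  upClosure∈𝒰 {A} (n , n∈A) = 𝒰-intro {upClosure A}
    (n , T-does⁺ em (n , n∈A , divides⁺ n n ∣-refl))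
    λ k m k∈ k∣m → let a , a∈A , a∣k = T-does⁻ (em {k ∈↑ A}) k∈ in
      T-does⁺ em (a , a∈A , divides⁺ a m (∣-trans (divides⁻ a k a∣k) (divides⁻ k m k∣m)))

  upClosure-large : ∀ F A → T (family F A) → T (family F (upClosure A))
  upClosure-large F A = upward F A _ λ n n∈A → T-does⁺ em (n , n∈A , divides⁺ n n ∣-refl)

  Typical : Ultrafilter → List Subset → ℕ⁺ → Set
  Typical F As n = All (λ A → T (family F A) ⇔ T (A n)) As

  typical-large : ∀ F As → T (family F (λ n → does (em {Typical F As n})))
  typical-large F [] = upward F _ _ (λ n _ → T-does⁺ em []) (whole F)
  typical-large F (A ∷ As) with ultra F A
  ... | inj₁ A∈F = upward F _ _
    (λ n h → let n∈A , t = to T-∧ h in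
      T-does⁺ em (mk⇔ (λ _ → n∈A) (λ _ → A∈F) ∷ T-does⁻ em t))
    (meet F _ _ A∈F (typical-large F As))
  ... | inj₂ Aᶜ∈F = upward F _ _
    (λ n h → let n∉A , t = to T-∧ h in
      T-does⁺ em (mk⇔ (λ A∈F → ⊥-elim (A∉F A∈F)) (λ n∈A → ⊥-elim (T-not⁻ n∉A n∈A)) ∷ T-does⁻ em t))
    (meet F _ _ Aᶜ∈F (typical-large F As))
    where
    T-not⁻ : ∀ {b} → T (not b) → ¬ T b
    T-not⁻ {false} _ ()
    A∉F : ¬ T (family F A)
    A∉F A∈F = proper F (upward F _ _ (λ n h → let n∈A , n∉A = to (T-∧ {A n}) h in T-not⁻ n∉A n∈A)
                                 (meet F _ _ A∈F Aᶜ∈F))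

  -- Upward closures of large sets pass from `F` to `G` and back. First `x′` is found above `B₁`,
  -- whose elements are typical for `G` and have a divisor typical for `F`; then `y` in `B₁` below
  -- `x′`, and `x` below `y`.
  interleaving : ∀ F G → family F =~ family G → ∀ As →
    ∃[ x ] ∃[ y ] ∃[ x′ ] Typical F As x × Typical G As y × Typical F As x′ ×
      T (divides (x , y)) × T (divides (y , x′))
  interleaving F G (F∣G , G∣F) As =
    let A  = λ n → does (em {Typical F As n})
        B  = λ n → does (em {Typical G As n})
        A∈F = typical-large F As
        B₁ = λ n → upClosure A n ∧ B n
        B₁∈G = meet G _ _ (F∣G _ (upClosure-large F A A∈F) (upClosure∈𝒰 (large⇒inhabited F A A∈F)))
                          (typical-large G As)
        x′ , h = large⇒inhabited F (λ n → upClosure B₁ n ∧ A n)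
                   (meet F _ _ (G∣F _ (upClosure-large G B₁ B₁∈G)
                                      (upClosure∈𝒰 (large⇒inhabited G B₁ B₁∈G))) A∈F)
        x′∈B₁↑ , x′∈A = to T-∧ h
        y , y∈B₁ , y∣x′ = T-does⁻ em x′∈B₁↑
        y∈A↑ , y∈B = to (T-∧ {upClosure A y}) y∈B₁
        x , x∈A , x∣y = T-does⁻ em y∈A↑
    in x , y , x′ , T-does⁻ em x∈A , T-does⁻ em y∈B , T-does⁻ em x′∈A , x∣y , y∣x′

-- Interleaved generators and the maximal separating power.

module Main (em : ExcludedMiddle 0ℓ) (ext : Extensionality 0ℓ 0ℓ)
            (N : NonstandardExtension) (sat : 𝔠⁺-Saturated N)
            (hip : HensonIsomorphismProperty N) where
  open Multiplicities em ext N sat hip public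
  open Counting em

  -- The three generators are coordinates of one object, so a single use of saturation finds them;
  -- finitely many conditions are met by `interleaving` and transfer.
  interleaved-generators : ∀ F G → family F =~ family G →
    ∃[ x ] ∃[ y ] ∃[ x′ ] x ⊨ family F × y ⊨ family G × x′ ⊨ family F × x *∣ y × y *∣ x′
  interleaved-generators F G F~G =
    let t , h = saturate sat (Subset↣ ext) [] φ fip
        _ , _ , _ , x∣y , y∣x′ = h (λ _ → true)
    in π₁ t , π₁ (π₂ t) , π₂ (π₂ t) ,
       (λ A → ⇔-sym (to (Sat-decide em) (proj₁ (h A)))) ,
       (λ A → ⇔-sym (to (Sat-decide em) (proj₁ (proj₂ (h A))))) ,
       (λ A → ⇔-sym (to (Sat-decide em) (proj₁ (proj₂ (proj₂ (h A)))))) , x∣y , y∣x′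
    where
    ⇔-sym : ∀ {P Q : Set} → P ⇔ Q → Q ⇔ P
    ⇔-sym e = mk⇔ (from e) (to e)
    σ : Ty
    σ = ι ⊗ ι ⊗ ι
    φ : Subset → Formula (σ ∷ [])
    φ A = decideᶠ (em {T (family F A)}) (fst v0 ∈ₛ A) ∧ᶠ
          (decideᶠ (em {T (family G A)}) (fst (snd v0) ∈ₛ A) ∧ᶠ
          (decideᶠ (em {T (family F A)}) (snd (snd v0) ∈ₛ A) ∧ᶠ
          ((fst v0 ∣ᶠ fst (snd v0)) ∧ᶠ (fst (snd v0) ∣ᶠ snd (snd v0)))))
    module C₀ = Closure standard (λ a → a)
    fip : ∀ As → ∃[ t ] All (λ A → Sat (t ∷ []) (φ A)) As
    fip As =
      let x , y , x′ , tx , ty , tx′ , x∣y , y∣x′ = Ultrafilters.interleaving em F G F~G As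
          t , h = to (transfer (∃ᶠ σ (⋀ᶠ φ As))) ((x , y , x′) ,
                    from (C₀.Sat-⋀ φ ((x , y , x′) ∷ []) As) (All.zipWith
                      (λ (e , e′ , e″) → from (C₀.Sat-decide em) e , from (C₀.Sat-decide em) e′ ,
                                         from (C₀.Sat-decide em) e″ , x∣y , y∣x′)
                      (tx , All.zip (ty , tx′))))
      in t , to (Sat-⋀ φ (t ∷ []) As) h

  module _ (F : Ultrafilter) {x x′ : *ℕ} (x⊨F : x ⊨ family F) (x′⊨F : x′ ⊨ family F)
           (x∣x′ : x *∣ x′) (x≢x′ : x ≢ x′) where

    W : *ℕ → *ℕ → Set
    W q c = q ∈′ ⋆ primes × Exact q c x′ × ¬ (q *^ c *∣ x)

    Attained : *ℕ → Subset → Set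
    Attained r A = ∃₂ λ q c → W q c × tp r ≋ tp q × 𝒰 A × q *^ c ∈′ ⋆ A

    -- By `∣~-linear` the larger of two candidates lies in the attained sets of both, so finitely
    -- many attained sets share a power from `W`. Saturation then gives one power that lies in all
    -- of them.
    maximal : ∀ r d → W r d →
      ∃₂ λ p b → W p b × tp r ≋ tp p × (∀ A → Attained r A → p *^ b ∈′ ⋆ A)
    maximal r d w =
      let y , h = saturate sat (Subset↣ ext) (x ∷ x′ ∷ []) φ fip in
      π₁ y , π₂ y , proj₁ (h (λ _ → true)) ,
      (λ A → to (Sat-decide em) (proj₁ (proj₂ (h A)))) , λ A → to (Sat-guard em) (proj₂ (proj₂ (h A)))
      where
      φ : Subset → Formula (ι ⊗ ι ∷ ι ∷ ι ∷ [])
      φ A = ((fst v0 ∈ₛ primes) ∧ᶠ (exactᶠ (fst v0) (snd v0) v2 ∧ᶠ (¬ᶠ (fst v0 ^ᵗ snd v0 ∣ᶠ v1)))) ∧ᶠ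
            (decideᶠ (em {r ∈′ ⋆ A}) (fst v0 ∈ₛ A) ∧ᶠ
             guard (em {Attained r A}) (fst v0 ^ᵗ snd v0 ∈ₛ A))
      Dominates : List Subset → *ℕ × *ℕ → Set
      Dominates As (q , c) = W q c × tp r ≋ tp q × All (λ A → Attained r A → q *^ c ∈′ ⋆ A) As
      dominating : ∀ As → ∃ (Dominates As)
      dominating [] = (r , d) , w , (λ _ → mk⇔ (λ h → h) (λ h → h)) , []
      dominating (A ∷ As) with dominating As | em {Attained r A}
      ... | qc , wq , r≋q , h | no ¬att = qc , wq , r≋q , (λ att → contradiction att ¬att) ∷ h
      ... | (q , c) , wq , r≋q , h | yes (q′ , c′ , wq′ , r≋q′ , A∈𝒰 , q′∈A)
        with ∣~-linear q q′ c c′ (≋-trans {tp q} {tp r} (≋-sym {tp r} {tp q} r≋q) r≋q′)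
      ...   | inj₁ q∣q′ = (q′ , c′) , wq′ , r≋q′ , (λ _ → q′∈A) ∷
        All.map (λ {A} h att@(_ , _ , _ , _ , A∈𝒰 , _) → q∣q′ A (h att) A∈𝒰) h
      ...   | inj₂ q′∣q = (q , c) , wq , r≋q , (λ _ → q′∣q A q′∈A A∈𝒰) ∷ h
      fip : ∀ As → ∃[ y ] All (λ A → Sat (y ∷ x ∷ x′ ∷ []) (φ A)) As
      fip As =
        let qc , h = dominating As
            wq , r≋q , dom = subst (Dominates As) (sym (unpair-pair qc)) h
        in ⟨ proj₁ qc , proj₂ qc ⟩ , All.map (λ {A} att →
             wq , from (Sat-decide em) (r≋q A) , from (Sat-guard em) att) dom

    conclusion : (∃[ B ] Multiplicity F B ∞)
      ⊎ (∃[ B ] SecondKind B × (∃[ κ ] κ ≢ fin 0 × Multiplicity F B κ))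
    conclusion
      with r , d , w ← separatingPower* x x′ x∣x′ x≢x′
      with p , b , (pp , p∥x′ , p∤x) , r≋p , max ← maximal r d w
      = case multiplicity-dichotomy B F of λ
        { (inj₂ m)       → inj₁ (B , m)
        -- The same `k` counts the occurrences in both generators; it is not 0, since `p *^ b` is
        -- exact in `x′`.
        ; (inj₁ (k , h)) → inj₂ (B , second k (h x x⊨F) (h x′ x′⊨F) , fin k ,
                                 nonzero k (h x′ x′⊨F) , Exactly⇒Multiplicity B F h) }
      where
      B : BasicClass
      B = record { 𝓟 = tp-ultrafilter p ; isPrime = pp ; p = p ; a = b
                 ; p⊨𝓟 = λ _ → mk⇔ (λ h → h) (λ h → h) }
      pb : Obj (ι ⊗ ι)
      pb = ⟨ p , b ⟩
      pb∈Occ : Occ B x′ pb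
      pb∈Occ = subst (Occurrences x′ B) (sym (unpair-pair (p , b)))
        (pp , generates⁺ B ((λ _ → mk⇔ (λ h → h) (λ h → h)) , (λ _ h _ → h) , λ _ h _ → h) ,
         to Exact⇔ExactPower p∥x′)
      pb∉Occ : ¬ Occ B x pb
      pb∉Occ o = let _ , _ , ex = subst (Occurrences x B) (unpair-pair (p , b)) o in
                 p∤x (exact⇒divides* p x b (from Exact⇔ExactPower ex))
      nonzero : ∀ k → Exactly k (Occ B x′) → fin k ≢ fin 0
      nonzero zero h _ = h pb pb∈Occ
      -- Maximality puts the type of `q *^ e` below that of `p *^ b`, which is below that of
      -- `q *^ c` and so, as `c *< e`, below that of `q *^ e` again. Thus `c` and `e` are two
      -- exponents of the class on `q`.
      shifted : ∀ q c e → BasicClass.u B (q , c) → W q e → c *< e → SecondKind B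
      shifted q c e u-c@(q≋p , qc∣pb , pb∣qc) w c<e = secondKind B {q} {c} {e} c<e u-c
        (q≋p , (λ A h A∈𝒰 → max A (q , e , w ,
                  ≋-trans {tp r} {tp p} {tp q} r≋p (≋-sym {tp q} {tp p} q≋p) , A∈𝒰 , h))
             , ∣~-trans {tp (p *^ b)} {tp (q *^ c)} {tp (q *^ e)} pb∣qc
                 (*∣⇒∣~ _ _ (*^-mono q c e (*≤-trans c _ e (*+-≤ c (⋆ 1⁺)) c<e))))
      shift : ∀ q c → Occurrences x B (q , c) → ¬ Occurrences x′ B (q , c) → SecondKind B
      shift q c (qp , gen , ex) ∉x′
        with e , q∥x′ , c≤e ← exact-lift* q x x′ c qp (from Exact⇔ExactPower ex) x∣x′
        with *≤⇒≡⊎< c e c≤e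
      ... | inj₁ refl = contradiction (qp , gen , to Exact⇔ExactPower q∥x′) ∉x′
      ... | inj₂ c<e  = shifted q c e (generates⁻ B qp gen)
        -- Since `e` exceeds the exact exponent `c` of `q` in `x`, `q *^ e` does not divide `x`.
        (qp , q∥x′ , λ d → *<⇒≱ c e c<e (exact-bound* q x c e qp (from Exact⇔ExactPower ex) d)) c<e
      -- Occ x and Occ x′ are finite of the same size, so Occ x has an element (q , c) outside
      -- Occ x′.  The exponent e of q in x′ then exceeds c, and by maximality q ^ e stays in the class.
      second : ∀ k → Exactly k (Occ B x) → Exactly k (Occ B x′) → SecondKind B
      second k hx hx′ with y , o , o∉ ← decidable-stable (em {∃[ y ] Occ B x y × ¬ Occ B x′ y})
        (λ ∄ → pb∉Occ (Exactly-⊆ k {Occ B x} {Occ B x′} hx hx′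
                         (λ y o → decidable-stable em λ o∉ → ∄ (y , o , o∉)) pb pb∈Occ))
        = shift (π₁ y) (π₂ y) o o∉

theorem5p3 : (∀ ℓ → Classical ℓ) →
    (N : NonstandardExtension) → 𝔠⁺-Saturated N → HensonIsomorphismProperty N →
    let open Patterns N in
    (F : Ultrafilter) → ¬ IsSingleton (=~Class F) →
    (∃[ B ] Multiplicity F B ∞)
    ⊎ (∃[ B ] SecondKind B × (∃[ κ ] κ ≢ fin 0 × Multiplicity F B κ))
theorem5p3 classical N sat hip F ¬singleton =
  let G , F~G , F≢G = distinctMember
      x , y , x′ , x⊨F , y⊨G , x′⊨F , x∣y , y∣x′ = interleaved-generators F G F~G
  -- If `x ≡ x′`, then `x` and `y` divide each other and coincide, so `F` and `G` would have a
  -- common generator.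
  in conclusion F x⊨F x′⊨F (*∣-trans x y x′ x∣y y∣x′) λ x≡x′ → F≢G
       (≋-trans {family F} {tp x} {family G} (≋-sym {tp x} {family F} x⊨F)
         (subst (λ z → tp z ≋ family G)
           (*∣-antisym y x (subst (y *∣_) (sym x≡x′) y∣x′) x∣y) y⊨G))
  where
  em : ExcludedMiddle 0ℓ
  em = proj₁ (classical 0ℓ)
  open Main em (proj₂ (classical 0ℓ)) N sat hip
  distinctMember : ∃[ G ] family F =~ family G × ¬ family F ≋ family G
  distinctMember = decidable-stable em λ ∄ → ¬singleton (F , λ G → mk⇔
    (λ F~G → ≋-sym {family F} {family G} (decidable-stable em λ F≢G → ∄ (G , F~G , F≢G)))
    (λ G≋F → ≋⇒=~ {family F} {family G} (≋-sym {family G} {family F} G≋F)))
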